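{- Let $(X,\mathbf R)$ be a symmetric association scheme with $D$ classes which is metric with respect to the ordering $A_0,A_1,\dots,A_D$. Fix $x\in X$ and write $E_i^*=E_i^*(x)$. Let $\chi\in V$ be a code, and set $\delta_x=\delta_x(\chi)$ and $s^*=s^*(\chi)$. Then for every $0\le \ell\le D$, the vector $A_\ell\chi$ is a relative $(\delta_x-s^*)$-codesign with respect to $x$; that is, $E_i^*A_\ell\chi\in\mathbb C A_i\hat x$ for all $1\le i\le \delta_x-s^*$.
   Context: $(X,\mathbf R)$, $\mathbf R=\{R_0,\dots,R_D\}$, is a symmetric association scheme with associate matrices $A_0=I,A_1,\dots,A_D$ (the $0/1$ adjacency matrices of the relations $R_i$), Bose–Mesner algebra $M=\mathrm{span}\{A_0,\dots,A_D\}$, and primitive idempotents $E_0=|X|^{ -1}J,E_1,\dots,E_D$ of $M$. Metric with respect to $A_0,\dots,A_D$ means $(X,R_1)$ is a distance-regular graph and $R_i$ is the distance-$i$ relation of this graph. $V=\mathbb C^X$ with standard basis $\{\hat y:y\in X\}$ and Hermitian inner product $\langle\hat y,\hat z\rangle=\delta_{yz}$. For $x\in X$, the dual idempotent $E_i^*(x)$ is the diagonal matrix with $(E_i^*(x))_{yy}=(A_i)_{xy}$. A vector $\chi\in V$ is a code if $\chi\notin E_0V$ and $\chi\notin E_0^*(z)V$ for every $z\in X$. $\delta_x(\chi)=\min\{i\ne0:E_i^*(x)\chi\ne0\}$ and $s^*(\chi)=|\{j\ne 0: E_j\chi\ne 0\}|$. A vector $\psi\in V$ is a relative $t$-codesign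 with respect to $x$ if $E_i^*(x)\psi$ and $A_i\hat x$ are linearly dependent for all $1\le i\le t$ (vacuous if $t\le 0$). -}

module Defs where

open import Algebra.Bundles using (CommutativeRing)
open import Data.Bool.Base using (if_then_else_)
open import Data.Fin.Base as Fin using (Fin; zero; suc; toℕ)
import Data.Fin.Properties as Fin
open import Data.Fin.Subset using (Subset; _∈_; ∣_∣)
open import Data.Integer.Base as ℤ using (ℤ; +_)
open import Data.Nat.Base as ℕ using (ℕ; zero; suc; NonZero)
import Data.Nat.Properties as ℕ
open import Data.Product using (Σ-syntax; ∃-syntax; ∃₂; ∃!; _×_; _,_; proj₁)
open import Data.Rational.Base as ℚ using (ℚ; 0ℚ; 1ℚ; ½)
import Data.Rational.Properties as ℚ
open import Data.Rational.Solver using (module +-*-Solver)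
open import Data.Vec.Functional using (Vector)
open import Function.Bundles using (_⇔_)
open import Level using (0ℓ)
open import Relation.Binary.Core using (Rel)
open import Relation.Binary.Definitions using (Symmetric; Irreflexive)
open import Relation.Binary.PropositionalEquality
  using (_≡_; refl; sym; trans; cong; cong₂; subst)
open import Relation.Nullary using (¬_)
open import Relation.Nullary.Decidable using (⌊_⌋)

Seq : Set
Seq = ℕ → ℚ

-- xₘ - yₙ → 0 as m, n → ∞ independently.  Thus Close x x says that x is a
-- Cauchy sequence, and for Cauchy sequences Close x y says that x and y
-- represent the same real number.
Close : Rel Seq 0ℓ
Close x y = ∀ ε → 0ℚ ℚ.< ε →
  ∃[ N ] ∀ m n → N ℕ.≤ m → N ℕ.≤ n → ℚ.∣ x m ℚ.- y n ∣ ℚ.≤ ε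

record ℝ : Set where
  constructor mkℝ
  field
    seq    : Seq
    cauchy : Close seq seq

open ℝ

record _≈ᴿ_ (x y : ℝ) : Set where
  constructor mk≈ᴿ
  field
    close : Close (seq x) (seq y)

open _≈ᴿ_

private
  module Bounds where
    open ℚ.≤-Reasoning
    open +-*-Solver

    abstract
      half : ∀ {ε} → 0ℚ ℚ.< ε → 0ℚ ℚ.< ½ ℚ.* ε
      half {ε} 0<ε =
        subst (ℚ._< ½ ℚ.* ε) (ℚ.*-zeroʳ ½) (ℚ.*-monoʳ-<-pos ½ 0<ε)

      half+half : ∀ ε → ½ ℚ.* ε ℚ.+ ½ ℚ.* ε ≡ ε
      half+half ε = trans (sym (ℚ.*-distribʳ-+ ε ½ ½)) (ℚ.*-identityˡ ε)

      close-sym : ∀ {x y} → Close x y → Close y x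
      close-sym {x} {y} p ε 0<ε with p ε 0<ε
      ... | N , h = N , λ m n N≤m N≤n → begin
        ℚ.∣ y m ℚ.- x n ∣
          ≡⟨ cong ℚ.∣_∣ (solve 2 (λ a b → b :- a := :- (a :- b)) refl (x n) (y m)) ⟩
        ℚ.∣ ℚ.- (x n ℚ.- y m) ∣  ≡⟨ ℚ.∣-p∣≡∣p∣ (x n ℚ.- y m) ⟩
        ℚ.∣ x n ℚ.- y m ∣        ≤⟨ h n m N≤n N≤m ⟩
        ε                        ∎

      close-trans : ∀ {x y z} → Close x y → Close y z → Close x z
      close-trans {x} {y} {z} p q ε 0<ε with p _ (half 0<ε) | q _ (half 0<ε)
      ... | N , h | K , k = N ℕ.⊔ K , λ m n ≤m ≤n → begin
        ℚ.∣ x m ℚ.- z n ∣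
          ≡⟨ cong ℚ.∣_∣ (solve 3 (λ a b c → a :- c := (a :- b) :+ (b :- c)) refl
               (x m) (y (N ℕ.⊔ K)) (z n)) ⟩
        ℚ.∣ (x m ℚ.- y (N ℕ.⊔ K)) ℚ.+ (y (N ℕ.⊔ K) ℚ.- z n) ∣
          ≤⟨ ℚ.∣p+q∣≤∣p∣+∣q∣ (x m ℚ.- y (N ℕ.⊔ K)) (y (N ℕ.⊔ K) ℚ.- z n) ⟩
        ℚ.∣ x m ℚ.- y (N ℕ.⊔ K) ∣ ℚ.+ ℚ.∣ y (N ℕ.⊔ K) ℚ.- z n ∣
          ≤⟨ ℚ.+-mono-≤
               (h m _ (ℕ.≤-trans (ℕ.m≤m⊔n N K) ≤m) (ℕ.m≤m⊔n N K))
               (k _ n (ℕ.m≤n⊔m N K) (ℕ.≤-trans (ℕ.m≤n⊔m N K) ≤n)) ⟩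
        ½ ℚ.* ε ℚ.+ ½ ℚ.* ε  ≡⟨ half+half ε ⟩
        ε                    ∎

      close-+ : ∀ {x y u v} → Close x y → Close u v →
                Close (λ n → x n ℚ.+ u n) (λ n → y n ℚ.+ v n)
      close-+ {x} {y} {u} {v} p q ε 0<ε with p _ (half 0<ε) | q _ (half 0<ε)
      ... | N , h | K , k = N ℕ.⊔ K , λ m n ≤m ≤n → begin
        ℚ.∣ (x m ℚ.+ u m) ℚ.- (y n ℚ.+ v n) ∣
          ≡⟨ cong ℚ.∣_∣ (solve 4 (λ a b c d →
               (a :+ c) :- (b :+ d) := (a :- b) :+ (c :- d)) refl
               (x m) (y n) (u m) (v n)) ⟩
        ℚ.∣ (x m ℚ.- y n) ℚ.+ (u m ℚ.- v n) ∣
          ≤⟨ ℚ.∣p+q∣≤∣p∣+∣q∣ (x m ℚ.- y n) (u m ℚ.- v n) ⟩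
        ℚ.∣ x m ℚ.- y n ∣ ℚ.+ ℚ.∣ u m ℚ.- v n ∣
          ≤⟨ ℚ.+-mono-≤
               (h m n (ℕ.≤-trans (ℕ.m≤m⊔n N K) ≤m) (ℕ.≤-trans (ℕ.m≤m⊔n N K) ≤n))
               (k m n (ℕ.≤-trans (ℕ.m≤n⊔m N K) ≤m) (ℕ.≤-trans (ℕ.m≤n⊔m N K) ≤n)) ⟩
        ½ ℚ.* ε ℚ.+ ½ ℚ.* ε  ≡⟨ half+half ε ⟩
        ε                    ∎

      close-neg : ∀ {x y} → Close x y → Close (λ n → ℚ.- x n) (λ n → ℚ.- y n)
      close-neg {x} {y} p ε 0<ε with p ε 0<ε
      ... | N , h = N , λ m n N≤m N≤n → begin
        ℚ.∣ ℚ.- x m ℚ.- ℚ.- y n ∣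
          ≡⟨ cong ℚ.∣_∣ (solve 2 (λ a b → :- a :- :- b := :- (a :- b)) refl (x m) (y n)) ⟩
        ℚ.∣ ℚ.- (x m ℚ.- y n) ∣  ≡⟨ ℚ.∣-p∣≡∣p∣ (x m ℚ.- y n) ⟩
        ℚ.∣ x m ℚ.- y n ∣        ≤⟨ h m n N≤m N≤n ⟩
        ε                        ∎

      bounded : ∀ {x y} → Close x y →
        ∃₂ λ N B → 0ℚ ℚ.< B × (∀ m → N ℕ.≤ m → ℚ.∣ x m ∣ ℚ.≤ B)
      bounded {x} {y} p with p 1ℚ (ℚ.positive⁻¹ 1ℚ)
      ... | N , h = N , 1ℚ ℚ.+ ℚ.∣ y N ∣ ,
        ℚ.+-mono-<-≤ (ℚ.positive⁻¹ 1ℚ) (ℚ.0≤∣p∣ (y N)) , λ m N≤m → begin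
        ℚ.∣ x m ∣
          ≡⟨ cong ℚ.∣_∣ (solve 2 (λ a b → a := (a :- b) :+ b) refl (x m) (y N)) ⟩
        ℚ.∣ (x m ℚ.- y N) ℚ.+ y N ∣        ≤⟨ ℚ.∣p+q∣≤∣p∣+∣q∣ (x m ℚ.- y N) (y N) ⟩
        ℚ.∣ x m ℚ.- y N ∣ ℚ.+ ℚ.∣ y N ∣    ≤⟨ ℚ.+-monoˡ-≤ ℚ.∣ y N ∣ (h m N N≤m ℕ.≤-refl) ⟩
        1ℚ ℚ.+ ℚ.∣ y N ∣                   ∎

      quotient : ∀ ε C → 0ℚ ℚ.< ε → 0ℚ ℚ.< C →
                 ∃[ δ ] 0ℚ ℚ.< δ × C ℚ.* δ ≡ ε
      quotient ε C 0<ε 0<C = ε ℚ.* ℚ.1/ C , ℚ.positive⁻¹ _ , (begin-equality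
        C ℚ.* (ε ℚ.* ℚ.1/ C)  ≡⟨ solve 3 (λ a b c → a :* (b :* c) := b :* (a :* c)) refl
                                   C ε (ℚ.1/ C) ⟩
        ε ℚ.* (C ℚ.* ℚ.1/ C)  ≡⟨ cong (ε ℚ.*_) (ℚ.*-inverseʳ C) ⟩
        ε ℚ.* 1ℚ              ≡⟨ ℚ.*-identityʳ ε ⟩
        ε                     ∎)
        where
        instance
          pε : ℚ.Positive ε
          pε = ℚ.positive 0<ε
          pC : ℚ.Positive C
          pC = ℚ.positive 0<C
          nC : ℚ.NonZero C
          nC = ℚ.pos⇒nonZero C
          pC⁻¹ : ℚ.Positive (ℚ.1/ C)
          pC⁻¹ = ℚ.1/pos⇒pos C
          pδ : ℚ.Positive (ε ℚ.* ℚ.1/ C)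
          pδ = ℚ.pos*pos⇒pos ε (ℚ.1/ C)

      *-bound : ∀ a b {A B} → 0ℚ ℚ.< A → ℚ.∣ a ∣ ℚ.≤ A → ℚ.∣ b ∣ ℚ.≤ B →
                ℚ.∣ a ℚ.* b ∣ ℚ.≤ A ℚ.* B
      *-bound a b {A} {B} 0<A a≤A b≤B = begin
        ℚ.∣ a ℚ.* b ∣        ≡⟨ ℚ.∣p*q∣≡∣p∣*∣q∣ a b ⟩
        ℚ.∣ a ∣ ℚ.* ℚ.∣ b ∣  ≤⟨ ℚ.*-monoʳ-≤-nonNeg ℚ.∣ b ∣ {{ℚ.∣-∣-nonNeg b}} a≤A ⟩
        A ℚ.* ℚ.∣ b ∣        ≤⟨ ℚ.*-monoˡ-≤-nonNeg A {{ℚ.pos⇒nonNeg A {{ℚ.positive 0<A}}}} b≤B ⟩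
        A ℚ.* B              ∎

      split : ∀ a b c d →
              a ℚ.* c ℚ.- b ℚ.* d ≡ a ℚ.* (c ℚ.- d) ℚ.+ (a ℚ.- b) ℚ.* d
      split a b c d = begin-equality
        a ℚ.* c ℚ.- b ℚ.* d
          ≡⟨ solve 3 (λ p q r → p :- r := (p :- q) :+ (q :- r)) refl
               (a ℚ.* c) (a ℚ.* d) (b ℚ.* d) ⟩
        (a ℚ.* c ℚ.- a ℚ.* d) ℚ.+ (a ℚ.* d ℚ.- b ℚ.* d)
          ≡⟨ cong₂ ℚ._+_
               (cong (a ℚ.* c ℚ.+_) (ℚ.neg-distribʳ-* a d))
               (cong (a ℚ.* d ℚ.+_) (ℚ.neg-distribˡ-* b d)) ⟩
        (a ℚ.* c ℚ.+ a ℚ.* (ℚ.- d)) ℚ.+ (a ℚ.* d ℚ.+ (ℚ.- b) ℚ.* d)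
          ≡⟨ sym (cong₂ ℚ._+_ (ℚ.*-distribˡ-+ a c (ℚ.- d)) (ℚ.*-distribʳ-+ d a (ℚ.- b))) ⟩
        a ℚ.* (c ℚ.- d) ℚ.+ (a ℚ.- b) ℚ.* d
          ∎

      close-*′ : ∀ {x y u v : Seq} {N₁ N₂ N₃ N₄ B C δ} → 0ℚ ℚ.< B → 0ℚ ℚ.< δ →
                 (∀ m → N₁ ℕ.≤ m → ℚ.∣ x m ∣ ℚ.≤ B) →
                 (∀ n → N₂ ℕ.≤ n → ℚ.∣ v n ∣ ℚ.≤ C) →
                 (∀ m n → N₃ ℕ.≤ m → N₃ ℕ.≤ n → ℚ.∣ x m ℚ.- y n ∣ ℚ.≤ δ) →
                 (∀ m n → N₄ ℕ.≤ m → N₄ ℕ.≤ n → ℚ.∣ u m ℚ.- v n ∣ ℚ.≤ δ) →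
                 ∃[ N ] ∀ m n → N ℕ.≤ m → N ℕ.≤ n →
                   ℚ.∣ x m ℚ.* u m ℚ.- y n ℚ.* v n ∣ ℚ.≤ (B ℚ.+ C) ℚ.* δ
      close-*′ {x} {y} {u} {v} {N₁} {N₂} {N₃} {N₄} {B} {C} {δ} 0<B 0<δ x≤B v≤C h k =
        N , λ m n ≤m ≤n → begin
        ℚ.∣ x m ℚ.* u m ℚ.- y n ℚ.* v n ∣
          ≡⟨ cong ℚ.∣_∣ (split (x m) (y n) (u m) (v n)) ⟩
        ℚ.∣ x m ℚ.* (u m ℚ.- v n) ℚ.+ (x m ℚ.- y n) ℚ.* v n ∣
          ≤⟨ ℚ.∣p+q∣≤∣p∣+∣q∣ (x m ℚ.* (u m ℚ.- v n)) ((x m ℚ.- y n) ℚ.* v n) ⟩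
        ℚ.∣ x m ℚ.* (u m ℚ.- v n) ∣ ℚ.+ ℚ.∣ (x m ℚ.- y n) ℚ.* v n ∣
          ≤⟨ ℚ.+-mono-≤
               (*-bound (x m) (u m ℚ.- v n) 0<B
                 (x≤B m (ℕ.≤-trans N₁≤ ≤m)) (k m n (ℕ.≤-trans N₄≤ ≤m) (ℕ.≤-trans N₄≤ ≤n)))
               (*-bound (x m ℚ.- y n) (v n) 0<δ
                 (h m n (ℕ.≤-trans N₃≤ ≤m) (ℕ.≤-trans N₃≤ ≤n)) (v≤C n (ℕ.≤-trans N₂≤ ≤n))) ⟩
        B ℚ.* δ ℚ.+ δ ℚ.* C  ≡⟨ cong (B ℚ.* δ ℚ.+_) (ℚ.*-comm δ C) ⟩
        B ℚ.* δ ℚ.+ C ℚ.* δ  ≡⟨ sym (ℚ.*-distribʳ-+ δ B C) ⟩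
        (B ℚ.+ C) ℚ.* δ      ∎
        where
        N : ℕ
        N = (N₁ ℕ.⊔ N₂) ℕ.⊔ (N₃ ℕ.⊔ N₄)
        N₁≤ : N₁ ℕ.≤ N
        N₁≤ = ℕ.≤-trans (ℕ.m≤m⊔n N₁ N₂) (ℕ.m≤m⊔n (N₁ ℕ.⊔ N₂) (N₃ ℕ.⊔ N₄))
        N₂≤ : N₂ ℕ.≤ N
        N₂≤ = ℕ.≤-trans (ℕ.m≤n⊔m N₁ N₂) (ℕ.m≤m⊔n (N₁ ℕ.⊔ N₂) (N₃ ℕ.⊔ N₄))
        N₃≤ : N₃ ℕ.≤ N
        N₃≤ = ℕ.≤-trans (ℕ.m≤m⊔n N₃ N₄) (ℕ.m≤n⊔m (N₁ ℕ.⊔ N₂) (N₃ ℕ.⊔ N₄))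
        N₄≤ : N₄ ℕ.≤ N
        N₄≤ = ℕ.≤-trans (ℕ.m≤n⊔m N₃ N₄) (ℕ.m≤n⊔m (N₁ ℕ.⊔ N₂) (N₃ ℕ.⊔ N₄))

      close-* : ∀ {x y u v} → Close x y → Close u v →
                Close (λ n → x n ℚ.* u n) (λ n → y n ℚ.* v n)
      close-* {x} {y} {u} {v} p q ε 0<ε =
        let N₁ , B , 0<B , x≤B = bounded {x} {y} p
            N₂ , C , 0<C , v≤C = bounded {v} {u} (close-sym {u} {v} q)
            δ , 0<δ , eq       = quotient ε (B ℚ.+ C) 0<ε (ℚ.+-mono-< 0<B 0<C)
            N₃ , h             = p δ 0<δ
            N₄ , k             = q δ 0<δ
            N , l              = close-*′ {x} {y} {u} {v} {N₁} {N₂} {N₃} {N₄}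
                                   0<B 0<δ x≤B v≤C h k
        in N , λ m n ≤m ≤n → ℚ.≤-trans (l m n ≤m ≤n) (ℚ.≤-reflexive eq)

      close-const : ∀ q → Close (λ _ → q) (λ _ → q)
      close-const q ε 0<ε = 0 , λ _ _ _ _ → begin
        ℚ.∣ q ℚ.- q ∣  ≡⟨ cong ℚ.∣_∣ (ℚ.+-inverseʳ q) ⟩
        0ℚ             ≤⟨ ℚ.<⇒≤ 0<ε ⟩
        ε              ∎

open Bounds

fromℚ : ℚ → ℝ
fromℚ q = mkℝ (λ _ → q) (close-const q)

infixl 6 _+ᴿ_
infixl 7 _*ᴿ_
infix  8 -ᴿ_

_+ᴿ_ : ℝ → ℝ → ℝ
mkℝ x p +ᴿ mkℝ y q = mkℝ (λ n → x n ℚ.+ y n) (close-+ {x} {x} {y} {y} p q)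

_*ᴿ_ : ℝ → ℝ → ℝ
mkℝ x p *ᴿ mkℝ y q = mkℝ (λ n → x n ℚ.* y n) (close-* {x} {x} {y} {y} p q)

-ᴿ_ : ℝ → ℝ
-ᴿ mkℝ x p = mkℝ (λ n → ℚ.- x n) (close-neg {x} {x} p)

pointwise : ∀ {x y} → (∀ n → seq x n ≡ seq y n) → x ≈ᴿ y
pointwise {x} {y} x≗y = mk≈ᴿ λ ε 0<ε →
  let N , h = cauchy x ε 0<ε in
  N , λ m n N≤m N≤n →
    subst (λ q → ℚ.∣ seq x m ℚ.- q ∣ ℚ.≤ ε) (x≗y n) (h m n N≤m N≤n)

ℝ-commutativeRing : CommutativeRing 0ℓ 0ℓ
ℝ-commutativeRing = record
  { Carrier = ℝ
  ; _≈_ = _≈ᴿ_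
  ; _+_ = _+ᴿ_
  ; _*_ = _*ᴿ_
  ; -_ = -ᴿ_
  ; 0# = fromℚ 0ℚ
  ; 1# = fromℚ 1ℚ
  ; isCommutativeRing = record
    { isRing = record
      { +-isAbelianGroup = record
        { isGroup = record
          { isMonoid = record
            { isSemigroup = record
              { isMagma = record
                { isEquivalence = record
                  { refl = λ {x} → mk≈ᴿ (cauchy x)
                  ; sym = λ {x} {y} p → mk≈ᴿ (close-sym {seq x} {seq y} (close p))
                  ; trans = λ {x} {y} {z} p q →
                      mk≈ᴿ (close-trans {seq x} {seq y} {seq z} (close p) (close q))
                  }
                ; ∙-cong = λ {x} {y} {u} {v} p q →
                    mk≈ᴿ (close-+ {seq x} {seq y} {seq u} {seq v} (close p) (close q))
                }
              ; assoc = λ x y z → pointwise λ n → ℚ.+-assoc (seq x n) (seq y n) (seq z n)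
              }
            ; identity = (λ x → pointwise λ n → ℚ.+-identityˡ (seq x n))
                       , (λ x → pointwise λ n → ℚ.+-identityʳ (seq x n))
            }
          ; inverse = (λ x → pointwise λ n → ℚ.+-inverseˡ (seq x n))
                    , (λ x → pointwise λ n → ℚ.+-inverseʳ (seq x n))
          ; ⁻¹-cong = λ {x} {y} p → mk≈ᴿ (close-neg {seq x} {seq y} (close p))
          }
        ; comm = λ x y → pointwise λ n → ℚ.+-comm (seq x n) (seq y n)
        }
      ; *-cong = λ {x} {y} {u} {v} p q →
          mk≈ᴿ (close-* {seq x} {seq y} {seq u} {seq v} (close p) (close q))
      ; *-assoc = λ x y z → pointwise λ n → ℚ.*-assoc (seq x n) (seq y n) (seq z n)
      ; *-identity = (λ x → pointwise λ n → ℚ.*-identityˡ (seq x n))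
                   , (λ x → pointwise λ n → ℚ.*-identityʳ (seq x n))
      ; distrib = (λ x y z → pointwise λ n → ℚ.*-distribˡ-+ (seq x n) (seq y n) (seq z n))
                , (λ x y z → pointwise λ n → ℚ.*-distribʳ-+ (seq x n) (seq y n) (seq z n))
      }
    ; *-comm = λ x y → pointwise λ n → ℚ.*-comm (seq x n) (seq y n)
    }
  }

infix 4 _≈ᶜ_

record ℂ : Set where
  constructor _+i_
  field
    re im : ℝ

open ℂ

record _≈ᶜ_ (w z : ℂ) : Set where
  constructor _,ᶜ_
  field
    re≈ : re w ≈ᴿ re z
    im≈ : im w ≈ᴿ im z

open _≈ᶜ_

infixl 6 _+ᶜ_
infixl 7 _*ᶜ_
infix  8 -ᶜ_

_+ᶜ_ : ℂ → ℂ → ℂ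
(a +i b) +ᶜ (c +i d) = (a +ᴿ c) +i (b +ᴿ d)

_*ᶜ_ : ℂ → ℂ → ℂ
(a +i b) *ᶜ (c +i d) = (a *ᴿ c +ᴿ -ᴿ (b *ᴿ d)) +i (a *ᴿ d +ᴿ b *ᴿ c)

-ᶜ_ : ℂ → ℂ
-ᶜ (a +i b) = (-ᴿ a) +i (-ᴿ b)

fromℚᶜ : ℚ → ℂ
fromℚᶜ q = fromℚ q +i fromℚ 0ℚ

private
  module Laws where
    open +-*-Solver

    *ᶜ-assoc : ∀ u v w → (u *ᶜ v) *ᶜ w ≈ᶜ u *ᶜ (v *ᶜ w)
    *ᶜ-assoc (a +i b) (c +i d) (e +i f) =
      pointwise (λ n → solve 6 (λ a b c d e f →
          (a :* c :+ :- (b :* d)) :* e :+ :- ((a :* d :+ b :* c) :* f) :=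
          a :* (c :* e :+ :- (d :* f)) :+ :- (b :* (c :* f :+ d :* e))) refl
          (seq a n) (seq b n) (seq c n) (seq d n) (seq e n) (seq f n))
      ,ᶜ
      pointwise (λ n → solve 6 (λ a b c d e f →
          (a :* c :+ :- (b :* d)) :* f :+ (a :* d :+ b :* c) :* e :=
          a :* (c :* f :+ d :* e) :+ b :* (c :* e :+ :- (d :* f))) refl
          (seq a n) (seq b n) (seq c n) (seq d n) (seq e n) (seq f n))

    *ᶜ-comm : ∀ u v → u *ᶜ v ≈ᶜ v *ᶜ u
    *ᶜ-comm (a +i b) (c +i d) =
      pointwise (λ n → solve 4 (λ a b c d →
          a :* c :+ :- (b :* d) := c :* a :+ :- (d :* b)) refl
          (seq a n) (seq b n) (seq c n) (seq d n))
      ,ᶜ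
      pointwise (λ n → solve 4 (λ a b c d →
          a :* d :+ b :* c := c :* b :+ d :* a) refl
          (seq a n) (seq b n) (seq c n) (seq d n))

    *ᶜ-identityˡ : ∀ u → fromℚᶜ 1ℚ *ᶜ u ≈ᶜ u
    *ᶜ-identityˡ (a +i b) =
      pointwise (λ n → solve 2 (λ a b →
          con 1ℚ :* a :+ :- (con 0ℚ :* b) := a) refl (seq a n) (seq b n))
      ,ᶜ
      pointwise (λ n → solve 2 (λ a b →
          con 1ℚ :* b :+ con 0ℚ :* a := b) refl (seq a n) (seq b n))

    *ᶜ-distribˡ : ∀ u v w → u *ᶜ (v +ᶜ w) ≈ᶜ u *ᶜ v +ᶜ u *ᶜ w
    *ᶜ-distribˡ (a +i b) (c +i d) (e +i f) =
      pointwise (λ n → solve 6 (λ a b c d e f →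
          a :* (c :+ e) :+ :- (b :* (d :+ f)) :=
          (a :* c :+ :- (b :* d)) :+ (a :* e :+ :- (b :* f))) refl
          (seq a n) (seq b n) (seq c n) (seq d n) (seq e n) (seq f n))
      ,ᶜ
      pointwise (λ n → solve 6 (λ a b c d e f →
          a :* (d :+ f) :+ b :* (c :+ e) :=
          (a :* d :+ b :* c) :+ (a :* f :+ b :* e)) refl
          (seq a n) (seq b n) (seq c n) (seq d n) (seq e n) (seq f n))

    ≈ᶜ-trans : ∀ {u v w} → u ≈ᶜ v → v ≈ᶜ w → u ≈ᶜ w
    ≈ᶜ-trans (p ,ᶜ q) (r ,ᶜ s) = ℝᴿ.trans p r ,ᶜ ℝᴿ.trans q s
      where module ℝᴿ = CommutativeRing ℝ-commutativeRing

open Laws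

ℂ-commutativeRing : CommutativeRing 0ℓ 0ℓ
ℂ-commutativeRing = record
  { Carrier = ℂ
  ; _≈_ = _≈ᶜ_
  ; _+_ = _+ᶜ_
  ; _*_ = _*ᶜ_
  ; -_ = -ᶜ_
  ; 0# = fromℚᶜ 0ℚ
  ; 1# = fromℚᶜ 1ℚ
  ; isCommutativeRing = record
    { isRing = record
      { +-isAbelianGroup = record
        { isGroup = record
          { isMonoid = record
            { isSemigroup = record
              { isMagma = record
                { isEquivalence = record
                  { refl = ℝᴿ.refl ,ᶜ ℝᴿ.refl
                  ; sym = λ (p ,ᶜ q) → ℝᴿ.sym p ,ᶜ ℝᴿ.sym q
                  ; trans = ≈ᶜ-trans
                  }
                ; ∙-cong = λ (p ,ᶜ q) (r ,ᶜ s) → ℝᴿ.+-cong p r ,ᶜ ℝᴿ.+-cong q s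
                }
              ; assoc = λ (a +i b) (c +i d) (e +i f) →
                  ℝᴿ.+-assoc a c e ,ᶜ ℝᴿ.+-assoc b d f
              }
            ; identity = (λ (a +i b) → ℝᴿ.+-identityˡ a ,ᶜ ℝᴿ.+-identityˡ b)
                       , (λ (a +i b) → ℝᴿ.+-identityʳ a ,ᶜ ℝᴿ.+-identityʳ b)
            }
          ; inverse = (λ (a +i b) → ℝᴿ.-‿inverseˡ a ,ᶜ ℝᴿ.-‿inverseˡ b)
                    , (λ (a +i b) → ℝᴿ.-‿inverseʳ a ,ᶜ ℝᴿ.-‿inverseʳ b)
          ; ⁻¹-cong = λ (p ,ᶜ q) → ℝᴿ.-‿cong p ,ᶜ ℝᴿ.-‿cong q
          }
        ; comm = λ (a +i b) (c +i d) → ℝᴿ.+-comm a c ,ᶜ ℝᴿ.+-comm b d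
        }
      ; *-cong = λ (p ,ᶜ q) (r ,ᶜ s) →
          ℝᴿ.+-cong (ℝᴿ.*-cong p r) (ℝᴿ.-‿cong (ℝᴿ.*-cong q s)) ,ᶜ
          ℝᴿ.+-cong (ℝᴿ.*-cong p s) (ℝᴿ.*-cong q r)
      ; *-assoc = *ᶜ-assoc
      ; *-identity = *ᶜ-identityˡ
                   , (λ u → ≈ᶜ-trans (*ᶜ-comm u _) (*ᶜ-identityˡ u))
      ; distrib = *ᶜ-distribˡ
                , (λ u v w → ≈ᶜ-trans (*ᶜ-comm (v +ᶜ w) u)
                    (≈ᶜ-trans (*ᶜ-distribˡ u v w)
                      (let p ,ᶜ q = *ᶜ-comm u v ; r ,ᶜ s = *ᶜ-comm u w
                       in ℝᴿ.+-cong p r ,ᶜ ℝᴿ.+-cong q s)))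
      }
    ; *-comm = *ᶜ-comm
    }
  }
  where module ℝᴿ = CommutativeRing ℝ-commutativeRing

open CommutativeRing ℂ-commutativeRing using (_≈_; _+_; _*_; 0#; 1#; +-monoid)
open import Algebra.Properties.Monoid.Sum +-monoid using (sum)

V : ℕ → Set
V n = Vector ℂ n

Matrix : ℕ → Set
Matrix n = Fin n → Fin n → ℂ

module _ {n : ℕ} where

  infix  4 _≈ⱽ_ _≈ᴹ_
  infixl 6 _+ᴹ_
  infixl 7 _*ᴹ_
  infixr 7 _·_

  _≈ⱽ_ : Rel (V n) 0ℓ
  v ≈ⱽ w = ∀ y → v y ≈ w y

  _≈ᴹ_ : Rel (Matrix n) 0ℓ
  B ≈ᴹ C = ∀ y z → B y z ≈ C y z

  0ⱽ : V n
  0ⱽ _ = 0#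

  0ᴹ : Matrix n
  0ᴹ _ _ = 0#

  _+ᴹ_ : Matrix n → Matrix n → Matrix n
  (B +ᴹ C) y z = B y z + C y z

  _*ᴹ_ : Matrix n → Matrix n → Matrix n
  (B *ᴹ C) y z = sum λ w → B y w * C w z

  _·_ : Matrix n → V n → V n
  (B · v) y = sum λ z → B y z * v z

  basis : Fin n → V n
  basis y z = if ⌊ y Fin.≟ z ⌋ then 1# else 0#

  diag : V n → Matrix n
  diag v y z = if ⌊ y Fin.≟ z ⌋ then v y else 0#

  _∈Image_ : V n → Matrix n → Set
  v ∈Image B = ∃[ w ] v ≈ⱽ B · w

  _∈Span_ : V n → V n → Set
  v ∈Span w = ∃[ a ] ∀ y → v y ≈ a * w y

  LinearlyDependent : V n → V n → Set
  LinearlyDependent v w =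
    ∃₂ λ a b → ¬ (a ≈ 0# × b ≈ 0#) × (∀ y → a * v y + b * w y ≈ 0#)

-- Sizes and minima are given as relations: equality in ℂ is not decidable, so
-- sets defined by the vanishing of vectors cannot be counted by computation.
HasCardinality : ∀ {n} → (Fin n → Set) → ℕ → Set
HasCardinality {n} P k =
  ∃[ S ] (∀ i → (i ∈ S) ⇔ P i) × ∣ S ∣ ≡ k

IsMinimum : ∀ {n} → (Fin n → Set) → Fin n → Set
IsMinimum P m = P m × (∀ i → P i → m Fin.≤ i)

module _ {n : ℕ} (_~_ : Rel (Fin n) 0ℓ) where

  data Walk : Fin n → Fin n → ℕ → Set where
    []  : ∀ {y} → Walk y y 0
    _∷_ : ∀ {y w z k} → y ~ w → Walk w z k → Walk y z (suc k)

  Distance : Fin n → Fin n → ℕ → Set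
  Distance y z k = Walk y z k × (∀ l → Walk y z l → k ℕ.≤ l)

  record IsDistanceRegular : Set where
    field
      symmetric   : Symmetric _~_
      irreflexive : Irreflexive _≡_ _~_
      connected   : ∀ y z → ∃[ k ] Walk y z k
      b c         : ℕ → ℕ
      b-count     : ∀ k y z → Distance y z k →
        HasCardinality (λ w → z ~ w × Distance y w (suc k)) (b k)
      c-count     : ∀ k y z → Distance y z k →
        HasCardinality (λ w → z ~ w × ∃[ j ] (suc j ≡ k × Distance y w j)) (c k)

record SymmetricAssociationScheme (n D : ℕ) : Set₁ where
  field
    R            : Fin (suc D) → Rel (Fin n) 0ℓ
    partition    : ∀ y z → ∃! _≡_ λ i → R i y z
    nonempty     : ∀ i → ∃₂ λ y z → R i y z
    diagonal     : ∀ y z → R zero y z ⇔ y ≡ z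
    symmetric    : ∀ i → Symmetric (R i)
    p            : (i j k : Fin (suc D)) → ℕ
    intersection : ∀ i j k y z → R k y z →
      HasCardinality (λ w → R i y w × R j w z) (p i j k)

  index : Fin n → Fin n → Fin (suc D)
  index y z = proj₁ (partition y z)

  -- R i y z holds exactly when index y z ≡ i.
  A : Fin (suc D) → Matrix n
  A i y z = if ⌊ index y z Fin.≟ i ⌋ then 1# else 0#

  -- The graph (X , R₁); phrased so as to make sense for D = 0 as well, where
  -- it has no edges.
  Γ : Rel (Fin n) 0ℓ
  Γ y z = ∃[ i ] toℕ i ≡ 1 × R i y z

  record Metric : Set where
    field
      distanceRegular : IsDistanceRegular Γ
      distance        : ∀ i y z → R i y z ⇔ Distance Γ y z (toℕ i)

  BoseMesner : Matrix n → Set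
  BoseMesner B =
    Σ[ c ∈ V (suc D) ] ∀ y z → B y z ≈ sum (λ i → c i * A i y z)

  record NonzeroIdempotent (F : Matrix n) : Set where
    field
      member     : BoseMesner F
      idempotent : F *ᴹ F ≈ᴹ F
      nonzero    : ¬ (F ≈ᴹ 0ᴹ)

  record PrimitiveIdempotent (F : Matrix n) : Set where
    field
      nonzeroIdempotent : NonzeroIdempotent F
      indecomposable    : ¬ (∃₂ λ G H →
        NonzeroIdempotent G × NonzeroIdempotent H ×
        G *ᴹ H ≈ᴹ 0ᴹ × H *ᴹ G ≈ᴹ 0ᴹ × F ≈ᴹ G +ᴹ H)

  ∣X∣⁻¹J : Matrix n
  ∣X∣⁻¹J _ _ = fromℚᶜ (+ 1 ℚ./ n)
    where
    instance
      n≢0 : NonZero n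
      n≢0 = Fin.nonZeroIndex (proj₁ (nonempty zero))

  -- E₀ , … , E_D lists the primitive idempotents of the Bose–Mesner algebra,
  -- each exactly once and starting with ∣X∣⁻¹J.
  record PrimitiveIdempotents (E : Fin (suc D) → Matrix n) : Set where
    field
      E₀        : E zero ≈ᴹ ∣X∣⁻¹J
      each      : ∀ j → PrimitiveIdempotent (E j)
      distinct  : ∀ i j → E i ≈ᴹ E j → i ≡ j
      complete  : ∀ F → PrimitiveIdempotent F → ∃[ j ] F ≈ᴹ E j

  E* : Fin (suc D) → Fin n → Matrix n
  E* i x = diag (A i x)

  record Code (E : Fin (suc D) → Matrix n) (χ : V n) : Set where
    field
      ∉E₀  : ¬ (χ ∈Image E zero)
      ∉E₀* : ∀ z → ¬ (χ ∈Image E* zero z)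

  -- IsRelativeMinimumDistance x χ δ says δ = δₓ(χ), and IsDualDegree E χ s says
  -- s = s*(χ).
  IsRelativeMinimumDistance : Fin n → V n → Fin (suc D) → Set
  IsRelativeMinimumDistance x χ =
    IsMinimum λ i → ¬ (i ≡ zero) × ¬ (E* i x · χ ≈ⱽ 0ⱽ)

  IsDualDegree : (Fin (suc D) → Matrix n) → V n → ℕ → Set
  IsDualDegree E χ =
    HasCardinality λ j → ¬ (j ≡ zero) × ¬ (E j · χ ≈ⱽ 0ⱽ)

  -- The bound t is an integer because t = δₓ(χ) - s*(χ) may be negative, in
  -- which case the condition is vacuous.
  RelativeCodesign : Fin n → ℤ → V n → Set
  RelativeCodesign x t ψ =
    ∀ i → 1 ℕ.≤ toℕ i → + toℕ i ℤ.≤ t →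
    LinearlyDependent (E* i x · ψ) (A i · basis x)

{-# OPTIONS --safe #-}

-- Equality of complex numbers is ¬¬-stable, so the argument may be classical.
-- The D + 1 distinct primitive idempotents are pairwise orthogonal, hence a
-- basis of the Bose–Mesner algebra M, and A₁ E_j = θ_j E_j; since the scheme is
-- metric, an eigenvector of A₁ in M is determined by its diagonal, so the θ_j
-- are distinct.  For y, y′ at distance i from x consider the linear functional
-- F B = (B χ)_y - (B χ)_y′ on M.  It kills E_0, every E_j with E_j χ = 0, and
-- every B supported on distances ≤ m with i + m < δₓ, because then B χ only
-- meets χ at x on the spheres in question.  If E_j χ ≠ 0, the product of
-- A₁ - θ_l over the s* - 1 other such l is supported on distances ≤ s* - 1, so
-- F kills it; only the j-th summand of its expansion in the idempotents
-- contributes, whence F E_j = 0.  Thus F = 0 on M, in particular F A_ℓ = 0.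

module Submission where

open import Defs
open import Algebra.Bundles using (CommutativeMonoid; CommutativeRing)
import Algebra.Properties.CommutativeMonoid.Sum as MonoidSum
import Algebra.Properties.CommutativeSemigroup as CommutativeSemigroupProperties
import Algebra.Properties.Monoid.Mult as Mult
import Algebra.Properties.Ring as RingProperties
import Algebra.Properties.Semiring.Sum as SemiringSum
import Algebra.Solver.Ring.NaturalCoefficients.Default as SemiringSolver
open import Data.Bool.Base using (if_then_else_)
open import Data.Fin.Base using (Fin; zero; suc; toℕ; fromℕ<; punchIn)
import Data.Fin.Properties as Fin
open import Data.Fin.Subset using (Subset; _∈_; ∣_∣; inside; outside; Nonempty)
open import Data.Fin.Subset.Properties
  using (_∈?_; drop-there; nonempty?; x∈p⇒∣p-x∣<∣p∣; Empty-unique; ∣⊥∣≡0)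
open import Data.Integer.Base as ℤ using (+_; _⊖_)
import Data.Integer.Properties as ℤ
open import Data.List.Base using (List; []; _∷_; length; map; filter)
open import Data.List.Membership.Propositional using () renaming (_∈_ to _∈ˡ_)
open import Data.List.Membership.Propositional.Properties
  using (∈-map⁺; ∈-filter⁺; ∈-filter⁻)
open import Data.List.Properties using (length-map; filter-notAll)
open import Data.List.Relation.Unary.Any as Any using (here; there)
open import Data.Nat.Base as ℕ using (ℕ; zero; suc)
import Data.Nat.Properties as ℕ
open import Data.Product.Base using (Σ-syntax; ∃-syntax; _×_; _,_; proj₁; proj₂)
open import Data.Rational.Base as ℚ using (ℚ; 0ℚ; 1ℚ; ½)
import Data.Rational.Properties as ℚ
open import Data.Rational.Solver using (module +-*-Solver)
open import Data.Sum.Base using (inj₁; inj₂; [_,_]′)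
open import Data.Vec.Base using ([]; _∷_; here; there)
open import Data.Vec.Functional using (insertAt; removeAt)
open import Data.Vec.Functional.Properties using (insertAt-lookup; insertAt-punchIn)
open import Function.Base using (_∘_)
open import Function.Bundles using (Equivalence)
open import Level using (_⊔_)
open import Relation.Binary.PropositionalEquality as ≡ using (_≡_; _≢_)
import Relation.Binary.Reasoning.Setoid as SetoidReasoning
open import Relation.Binary.Structures using (IsEquivalence)
open import Relation.Nullary using (¬_; ¬?; yes; no; contradiction)
open import Relation.Nullary.Decidable using (⌊_⌋; toSum)

-- Finite subsets as lists.

elements : ∀ {n} → Subset n → List (Fin n)
elements []            = []
elements (inside  ∷ S) = zero ∷ map suc (elements S)
elements (outside ∷ S) = map suc (elements S)

length-elements : ∀ {n} (S : Subset n) → length (elements S) ≡ ∣ S ∣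
length-elements []            = ≡.refl
length-elements (inside  ∷ S) = ≡.cong suc (≡.trans (length-map suc (elements S)) (length-elements S))
length-elements (outside ∷ S) = ≡.trans (length-map suc (elements S)) (length-elements S)

∈-elements : ∀ {n} {S : Subset n} {i} → i ∈ S → i ∈ˡ elements S
∈-elements {S = inside  ∷ S} here      = here ≡.refl
∈-elements {S = inside  ∷ S} (there p) = there (∈-map⁺ suc (∈-elements p))
∈-elements {S = outside ∷ S} (there p) = ∈-map⁺ suc (∈-elements p)

x∈p⇒∣p∣>0 : ∀ {n} {S : Subset n} {i} → i ∈ S → 0 ℕ.< ∣ S ∣
x∈p⇒∣p∣>0 i∈S = ℕ.≤-<-trans ℕ.z≤n (x∈p⇒∣p-x∣<∣p∣ i∈S)

∣p∣>0⇒Nonempty : ∀ {n} {S : Subset n} → 0 ℕ.< ∣ S ∣ → Nonempty S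
∣p∣>0⇒Nonempty {n} {S} 0<∣S∣ with nonempty? S
... | yes ne   = ne
... | no empty = contradiction (≡.trans (≡.cong ∣_∣ (Empty-unique empty)) (∣⊥∣≡0 n)) (ℕ.>⇒≢ 0<∣S∣)

-- Finite sums and indicators.

module _ {c ℓ} (M : CommutativeMonoid c ℓ) where
  open CommutativeMonoid M
  open MonoidSum M
  open SetoidReasoning setoid

  sum-ε : ∀ {n} (t : Fin n → Carrier) → (∀ i → t i ≈ ε) → sum t ≈ ε
  sum-ε {n} t t≈ε = trans (sum-cong-≋ t≈ε) (sum-replicate-zero n)

  sum-single : ∀ {n} (k : Fin n) (t : Fin n → Carrier) →
               (∀ i → i ≢ k → t i ≈ ε) → sum t ≈ t k
  sum-single {suc n} k t t≈ε = begin
    sum t                       ≈⟨ sum-remove {i = k} t ⟩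
    t k ∙ sum (removeAt t k)    ≈⟨ ∙-congˡ (sum-ε (removeAt t k) λ i → t≈ε _ (Fin.punchInᵢ≢i k i)) ⟩
    t k ∙ ε                     ≈⟨ identityʳ (t k) ⟩
    t k                         ∎

module _ {c ℓ} (K : CommutativeRing c ℓ) where
  open CommutativeRing K hiding (zero)
  open SemiringSum semiring

  sum-indicatorˡ : ∀ {n} a (f : Fin n → Carrier) y →
                   sum (λ z → (if ⌊ y Fin.≟ z ⌋ then a else 0#) * f z) ≈ a * f y
  sum-indicatorˡ a f y = trans (sum-single +-commutativeMonoid y _ off) on
    where
    off : ∀ z → z ≢ y → (if ⌊ y Fin.≟ z ⌋ then a else 0#) * f z ≈ 0#
    off z z≢y with y Fin.≟ z
    ... | yes y≡z = contradiction (≡.sym y≡z) z≢y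
    ... | no _    = zeroˡ (f z)
    on : (if ⌊ y Fin.≟ y ⌋ then a else 0#) * f y ≈ a * f y
    on with y Fin.≟ y
    ... | yes _  = refl
    ... | no y≢y = contradiction ≡.refl y≢y

  sum-indicatorʳ : ∀ {n} (f : Fin n → Carrier) x →
                   sum (λ z → f z * (if ⌊ x Fin.≟ z ⌋ then 1# else 0#)) ≈ f x
  sum-indicatorʳ f x = trans (sum-cong-≋ λ z → *-comm (f z) _)
    (trans (sum-indicatorˡ 1# f x) (*-identityˡ (f x)))

  indicator-*-cong : ∀ {n} {k i : Fin n} {a b} → (k ≡ i → a ≈ b) →
    (if ⌊ k Fin.≟ i ⌋ then 1# else 0#) * a ≈ b * (if ⌊ k Fin.≟ i ⌋ then 1# else 0#)
  indicator-*-cong {k = k} {i} {a} {b} a≈b with k Fin.≟ i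
  ... | yes k≡i = trans (*-identityˡ a) (trans (a≈b k≡i) (sym (*-identityʳ b)))
  ... | no _    = trans (zeroˡ a) (sym (zeroʳ b))

-- Linear dependence over a domain with stable equality.

-- A domain rather than a field: for Cauchy sequences, nonzeroness is a bare negation and supplies
-- no bound away from zero from which to form an inverse. Stability of `≈` lets equations be proved
-- by contradiction.
record IsDomainOfCharacteristicZero {c ℓ} (K : CommutativeRing c ℓ) : Set (c ⊔ ℓ) where
  open CommutativeRing K
  open Mult +-monoid using () renaming (_×_ to _·ℕ_)
  field
    ≈-stable           : ∀ {a b} → ¬ ¬ a ≈ b → a ≈ b
    noZeroDivisors     : ∀ {a b} → a * b ≈ 0# → ¬ a ≈ 0# → b ≈ 0#
    characteristicZero : ∀ m → ¬ suc m ·ℕ 1# ≈ 0#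

  1≉0 : ¬ 1# ≈ 0#
  1≉0 1≈0 = characteristicZero 0 (trans (+-identityʳ 1#) 1≈0)

module LinearDependence {c ℓ} {K : CommutativeRing c ℓ}
  (domain : IsDomainOfCharacteristicZero K) where

  open CommutativeRing K hiding (zero)
  open IsDomainOfCharacteristicZero domain
  open SemiringSum semiring
  open SemiringSolver commutativeSemiring
  open SetoidReasoning setoid

  -- Nontriviality is stated negatively; no index with a nonzero coefficient is exhibited.
  Dependent : ∀ {n m} → (Fin n → Fin m → Carrier) → Set _
  Dependent {n} v = Σ[ a ∈ (Fin n → Carrier) ]
    ¬ (∀ i → a i ≈ 0#) × (∀ k → sum (λ i → a i * v i k) ≈ 0#)

  module Eliminate {n m} (v : Fin (suc n) → Fin (suc m) → Carrier)
    (p : Fin (suc n)) (pivot≉0 : ¬ v p zero ≈ 0#) where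

    -- Fraction-free elimination: each row is cross-multiplied with the pivot row, which clears
    -- column zero without division.
    reduced : Fin n → Fin (suc m) → Carrier
    reduced i k = v p zero * v (punchIn p i) k + - v (punchIn p i) zero * v p k

    reduced-zero : ∀ i → reduced i zero ≈ 0#
    reduced-zero i = begin
      v p zero * u + - u * v p zero  ≈⟨ +-congʳ (*-comm (v p zero) u) ⟩
      u * v p zero + - u * v p zero  ≈⟨ distribʳ (v p zero) u (- u) ⟨
      (u + - u) * v p zero           ≈⟨ *-congʳ (-‿inverseʳ u) ⟩
      0# * v p zero                  ≈⟨ zeroˡ (v p zero) ⟩
      0#                             ∎
      where
      u : Carrier
      u = v (punchIn p i) zero

    -- The coefficients of the other rows are scaled by the pivot, and the pivot row receives `aₚ`,
    -- the total of the multiples of it that were subtracted. Cancelling the pivot shows that the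
    -- lifted relation is still nontrivial.
    lift : Dependent (λ i k → reduced i (suc k)) → Dependent v
    lift (d , d≉0 , d-rel) = a , a≉0 , a-rel
      where
      aₚ : Carrier
      aₚ = sum λ i → d i * - v (punchIn p i) zero
      a : Fin (suc n) → Carrier
      a = insertAt (λ i → v p zero * d i) p aₚ
      a-pivot : a p ≈ aₚ
      a-pivot = reflexive (insertAt-lookup (λ i → v p zero * d i) p aₚ)
      a-rest : ∀ i → a (punchIn p i) ≈ v p zero * d i
      a-rest i = reflexive (insertAt-punchIn (λ i → v p zero * d i) p aₚ i)
      a≉0 : ¬ (∀ i → a i ≈ 0#)
      a≉0 a≈0 = d≉0 λ i → noZeroDivisors (trans (sym (a-rest i)) (a≈0 _)) pivot≉0
      d-rel′ : ∀ k → sum (λ i → d i * reduced i k) ≈ 0#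
      d-rel′ zero    = sum-ε +-commutativeMonoid _ λ i →
        trans (*-congˡ (reduced-zero i)) (zeroʳ (d i))
      d-rel′ (suc k) = d-rel k
      a-rel : ∀ k → sum (λ i → a i * v i k) ≈ 0#
      a-rel k = begin
        sum (λ i → a i * v i k)
          ≈⟨ sum-remove {i = p} (λ i → a i * v i k) ⟩
        a p * v p k + sum (λ i → a (punchIn p i) * v (punchIn p i) k)
          ≈⟨ +-cong (*-congʳ a-pivot) (sum-cong-≋ λ i → *-congʳ (a-rest i)) ⟩
        aₚ * v p k + sum (λ i → v p zero * d i * v (punchIn p i) k)
          ≈⟨ +-congʳ (*-distribʳ-sum (v p k) λ i → d i * - v (punchIn p i) zero) ⟩
        sum (λ i → d i * - v (punchIn p i) zero * v p k) +
          sum (λ i → v p zero * d i * v (punchIn p i) k)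
          ≈⟨ ∑-distrib-+ (λ i → d i * - v (punchIn p i) zero * v p k) _ ⟨
        sum (λ i → d i * - v (punchIn p i) zero * v p k + v p zero * d i * v (punchIn p i) k)
          ≈⟨ sum-cong-≋ (λ i → solve 5 (λ d m w α u →
               d :* m :* w :+ α :* d :* u := d :* (α :* u :+ m :* w)) refl
               (d i) (- v (punchIn p i) zero) (v p k) (v p zero) (v (punchIn p i) k)) ⟩
        sum (λ i → d i * reduced i k)
          ≈⟨ d-rel′ k ⟩
        0# ∎

  -- Induction on the number of columns. A nonzero entry in column zero would serve as a pivot, so
  -- under the assumption `¬dep` stability makes the whole column vanish.
  dependent : ∀ {m} (v : Fin (suc m) → Fin m → Carrier) → ¬ ¬ Dependent v
  dependent {zero}  v ¬dep = ¬dep ((λ _ → 1#) , (λ 1≈0 → 1≉0 (1≈0 zero)) , λ ())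
  dependent {suc m} v ¬dep = dependent (λ i k → v (suc i) (suc k))
    λ (a , a≉0 , a-rel) → ¬dep (insertAt a zero 0# , (λ a≈0 → a≉0 (a≈0 ∘ suc)) , λ where
      zero    → sum-ε +-commutativeMonoid _ λ i → trans (*-congˡ (column₀≈0 i)) (zeroʳ (insertAt a zero 0# i))
      (suc k) → trans (+-cong (zeroˡ _) (a-rel k)) (+-identityˡ 0#))
    where
    column₀≈0 : ∀ p → v p zero ≈ 0#
    column₀≈0 p = ≈-stable λ pivot≉0 →
      dependent (λ i k → Eliminate.reduced v p pivot≉0 i (suc k))
        (¬dep ∘ Eliminate.lift v p pivot≉0)

-- Real numbers: stability and absence of zero divisors.

module _ where
  open ℝ
  open _≈ᴿ_
  module ℝᴿ = CommutativeRing ℝ-commutativeRing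
  open +-*-Solver
  open ≡ using (refl; sym; cong; subst)

  -- The positive form of being nonzero; its negation is equivalent to being zero, which makes
  -- equality of reals stable.
  EventuallyApart : Seq → Set
  EventuallyApart x =
    ∃[ ε ] 0ℚ ℚ.< ε × ∃[ N ] ∀ n → N ℕ.≤ n → ε ℚ.< ℚ.∣ x n ∣

  apart⇒≉0 : ∀ {x} → EventuallyApart (seq x) → ¬ x ℝᴿ.≈ fromℚ 0ℚ
  apart⇒≉0 {x} (ε , 0<ε , N , ε<) x≈0 with close x≈0 ε 0<ε
  ... | K , h = ℚ.<-irrefl refl (ℚ.<-≤-trans (ε< m (ℕ.m≤m⊔n N K)) (subst (ℚ._≤ ε)
      (cong ℚ.∣_∣ (ℚ.+-identityʳ (seq x m))) (h m m (ℕ.m≤n⊔m N K) (ℕ.m≤n⊔m N K))))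
    where
    m : ℕ
    m = N ℕ.⊔ K

  -- From an index `N` on, terms differ by at most `δ`. Comparing the rational `∣ x_N ∣` with
  -- `δ + δ` is decidable: if it is larger, the tail stays above `δ` and the sequence is apart;
  -- otherwise the tail stays within `3δ`.
  ¬apart⇒≈0 : ∀ x → ¬ EventuallyApart (seq x) → x ℝᴿ.≈ fromℚ 0ℚ
  ¬apart⇒≈0 x ¬apart = mk≈ᴿ λ ε 0<ε →
    -- A quarter of `ε`, which leaves room for the bound `3δ`.
    let δ      = ½ ℚ.* (½ ℚ.* ε)
        0<δ    = half (half 0<ε)
        N , h  = cauchy x δ 0<δ
    in N , λ m _ N≤m _ → bound ε δ 0<δ (double ε) N h m N≤m
    where
    half : ∀ {ε} → 0ℚ ℚ.< ε → 0ℚ ℚ.< ½ ℚ.* ε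
    half {ε} 0<ε = subst (ℚ._< ½ ℚ.* ε) (ℚ.*-zeroʳ ½) (ℚ.*-monoʳ-<-pos ½ 0<ε)
    double : ∀ ε → let δ = ½ ℚ.* (½ ℚ.* ε) in (δ ℚ.+ δ) ℚ.+ (δ ℚ.+ δ) ≡ ε
    double ε = solve 1 (λ e → let d = con ½ :* (con ½ :* e) in (d :+ d) :+ (d :+ d) := e) refl ε
    module _ (ε δ : ℚ) (0<δ : 0ℚ ℚ.< δ) (4δ≡ε : (δ ℚ.+ δ) ℚ.+ (δ ℚ.+ δ) ≡ ε) (N : ℕ)
      (h : ∀ m n → N ℕ.≤ m → N ℕ.≤ n → ℚ.∣ seq x m ℚ.- seq x n ∣ ℚ.≤ δ) where
      open ℚ.≤-Reasoning
      shift : ∀ {B} m n → N ℕ.≤ m → N ℕ.≤ n →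
              ℚ.∣ seq x n ∣ ℚ.≤ B → ℚ.∣ seq x m ∣ ℚ.≤ δ ℚ.+ B
      shift {B} m n N≤m N≤n ≤B = begin
        ℚ.∣ seq x m ∣
          ≡⟨ cong ℚ.∣_∣ (solve 2 (λ a b → a := (a :- b) :+ b) refl (seq x m) (seq x n)) ⟩
        ℚ.∣ (seq x m ℚ.- seq x n) ℚ.+ seq x n ∣
          ≤⟨ ℚ.∣p+q∣≤∣p∣+∣q∣ (seq x m ℚ.- seq x n) (seq x n) ⟩
        ℚ.∣ seq x m ℚ.- seq x n ∣ ℚ.+ ℚ.∣ seq x n ∣
          ≤⟨ ℚ.+-mono-≤ (h m n N≤m N≤n) ≤B ⟩
        δ ℚ.+ B ∎
      bound : ∀ m → N ℕ.≤ m → ℚ.∣ seq x m ℚ.- 0ℚ ∣ ℚ.≤ ε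
      bound m N≤m with ℚ.∣ seq x N ∣ ℚ.≤? δ ℚ.+ δ
      ... | yes ≤2δ = begin
        ℚ.∣ seq x m ℚ.- 0ℚ ∣      ≡⟨ cong ℚ.∣_∣ (ℚ.+-identityʳ (seq x m)) ⟩
        ℚ.∣ seq x m ∣             ≤⟨ shift m N N≤m ℕ.≤-refl ≤2δ ⟩
        δ ℚ.+ (δ ℚ.+ δ)           ≡⟨ cong (ℚ._+ (δ ℚ.+ δ)) (ℚ.+-identityʳ δ) ⟨
        (δ ℚ.+ 0ℚ) ℚ.+ (δ ℚ.+ δ)  ≤⟨ ℚ.+-monoˡ-≤ (δ ℚ.+ δ) (ℚ.+-monoʳ-≤ δ (ℚ.<⇒≤ 0<δ)) ⟩
        (δ ℚ.+ δ) ℚ.+ (δ ℚ.+ δ)   ≡⟨ 4δ≡ε ⟩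
        ε                         ∎
      ... | no ≰2δ = contradiction
        (δ , 0<δ , N , λ n N≤n → ℚ.≰⇒> λ ≤δ → ≰2δ (shift N n ℕ.≤-refl N≤n ≤δ)) ¬apart

  apart-* : ∀ {x y : Seq} → EventuallyApart x → EventuallyApart y →
            EventuallyApart (λ n → x n ℚ.* y n)
  apart-* {x} {y} (ε , 0<ε , N , ε<) (η , 0<η , K , η<) =
    ε ℚ.* η , ℚ.positive⁻¹ _ {{ℚ.pos*pos⇒pos ε {{ℚ.positive 0<ε}} η {{ℚ.positive 0<η}}}} ,
    N ℕ.⊔ K , λ n ≤n → begin-strict
      ε ℚ.* η                      <⟨ ℚ.*-monoˡ-<-pos η {{ℚ.positive 0<η}} (ε< n (ℕ.m⊔n≤o⇒m≤o N K ≤n)) ⟩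
      ℚ.∣ x n ∣ ℚ.* η              ≤⟨ ℚ.*-monoˡ-≤-nonNeg ℚ.∣ x n ∣ {{ℚ.∣-∣-nonNeg (x n)}}
                                        (ℚ.<⇒≤ (η< n (ℕ.m⊔n≤o⇒n≤o N K ≤n))) ⟩
      ℚ.∣ x n ∣ ℚ.* ℚ.∣ y n ∣      ≡⟨ ℚ.∣p*q∣≡∣p∣*∣q∣ (x n) (y n) ⟨
      ℚ.∣ x n ℚ.* y n ∣            ∎
    where open ℚ.≤-Reasoning

  ≈ᴿ-stable : ∀ {x y} → ¬ ¬ x ℝᴿ.≈ y → x ℝᴿ.≈ y
  ≈ᴿ-stable {x} {y} ¬¬x≈y = x∙y⁻¹≈ε⇒x≈y x y (¬apart⇒≈0 (x +ᴿ -ᴿ y) λ apart →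
      ¬¬x≈y λ x≈y → apart⇒≉0 {x +ᴿ -ᴿ y} apart (x≈y⇒x∙y⁻¹≈ε x≈y))
    where open RingProperties ℝᴿ.ring using (x∙y⁻¹≈ε⇒x≈y; x≈y⇒x∙y⁻¹≈ε)

  -- If both factors were apart from zero, the product of their bounds would keep the product apart
  -- from zero.
  ℝ-noZeroDivisors : ∀ x y → x *ᴿ y ℝᴿ.≈ fromℚ 0ℚ → ¬ x ℝᴿ.≈ fromℚ 0ℚ → y ℝᴿ.≈ fromℚ 0ℚ
  ℝ-noZeroDivisors x y xy≈0 x≉0 = ¬apart⇒≈0 y λ y-apart → x≉0 (¬apart⇒≈0 x λ x-apart →
    apart⇒≉0 {x *ᴿ y} (apart-* {seq x} {seq y} x-apart y-apart) xy≈0)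

  square≈0 : ∀ x → x *ᴿ x ℝᴿ.≈ fromℚ 0ℚ → x ℝᴿ.≈ fromℚ 0ℚ
  square≈0 x xx≈0 = ≈ᴿ-stable λ x≉0 → x≉0 (ℝ-noZeroDivisors x x xx≈0 x≉0)

  -- Termwise `0 ≤ x² ≤ x² + y²`, so every bound on the sum is a bound on the first square.
  sumOfSquares≈0ˡ : ∀ x y → x *ᴿ x +ᴿ y *ᴿ y ℝᴿ.≈ fromℚ 0ℚ → x ℝᴿ.≈ fromℚ 0ℚ
  sumOfSquares≈0ˡ x y p = square≈0 x (mk≈ᴿ λ ε 0<ε →
    let N , h = close p ε 0<ε in N , λ m n N≤m N≤n → begin
      ℚ.∣ a m ℚ.- 0ℚ ∣           ≡⟨ cong ℚ.∣_∣ (ℚ.+-identityʳ (a m)) ⟩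
      ℚ.∣ a m ∣                  ≡⟨ ℚ.0≤p⇒∣p∣≡p (0≤sq (seq x m)) ⟩
      a m                        ≡⟨ ℚ.+-identityʳ (a m) ⟨
      a m ℚ.+ 0ℚ                 ≤⟨ ℚ.+-monoʳ-≤ (a m) (0≤sq (seq y m)) ⟩
      a m ℚ.+ b m                ≡⟨ ℚ.0≤p⇒∣p∣≡p (ℚ.+-mono-≤ (0≤sq (seq x m)) (0≤sq (seq y m))) ⟨
      ℚ.∣ a m ℚ.+ b m ∣          ≡⟨ cong ℚ.∣_∣ (ℚ.+-identityʳ (a m ℚ.+ b m)) ⟨
      ℚ.∣ a m ℚ.+ b m ℚ.- 0ℚ ∣   ≤⟨ h m n N≤m N≤n ⟩
      ε                          ∎)
    where
    open ℚ.≤-Reasoning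
    a b : Seq
    a m = seq x m ℚ.* seq x m
    b m = seq y m ℚ.* seq y m
    0≤sq : ∀ q → 0ℚ ℚ.≤ q ℚ.* q
    0≤sq q = subst (0ℚ ℚ.≤_) ∣q∣²≡q² (ℚ.nonNegative⁻¹ _
        {{ℚ.nonNeg*nonNeg⇒nonNeg ℚ.∣ q ∣ {{ℚ.∣-∣-nonNeg q}} ℚ.∣ q ∣ {{ℚ.∣-∣-nonNeg q}}}})
      where
      ∣q∣²≡q² : ℚ.∣ q ∣ ℚ.* ℚ.∣ q ∣ ≡ q ℚ.* q
      ∣q∣²≡q² with ℚ.∣p∣≡p∨∣p∣≡-p q
      ... | inj₁ eq rewrite eq = refl
      ... | inj₂ eq rewrite eq = solve 1 (λ a → :- a :* :- a := a :* a) refl q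

  sumOfSquares≈0ʳ : ∀ x y → x *ᴿ x +ᴿ y *ᴿ y ℝᴿ.≈ fromℚ 0ℚ → y ℝᴿ.≈ fromℚ 0ℚ
  sumOfSquares≈0ʳ x y p = sumOfSquares≈0ˡ y x (ℝᴿ.trans (ℝᴿ.+-comm (y *ᴿ y) (x *ᴿ x)) p)

-- Complex numbers as a domain of characteristic zero.

module _ where
  open ℝ
  open ℂ
  open _≈ᶜ_
  open CommutativeRing ℂ-commutativeRing using (_≈_; _*_; 0#; 1#; +-monoid)
  open Mult +-monoid using () renaming (_×_ to _·ℕ_)
  open +-*-Solver
  open ≡ using (refl; sym; subst)

  ≈ᶜ-stable : ∀ {w z} → ¬ ¬ w ≈ z → w ≈ z
  ≈ᶜ-stable ¬¬w≈z = ≈ᴿ-stable (λ ¬p → ¬¬w≈z λ w≈z → ¬p (re≈ w≈z)) ,ᶜ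
                    ≈ᴿ-stable (λ ¬p → ¬¬w≈z λ w≈z → ¬p (im≈ w≈z))

  -- Multiply by the conjugate of w: ∣w∣² z = w̄ (w z).
  ℂ-noZeroDivisors : ∀ {w z} → w * z ≈ 0# → ¬ w ≈ 0# → z ≈ 0#
  ℂ-noZeroDivisors {a +i b} {c +i d} (p ,ᶜ q) w≉0 =
    ℝ-noZeroDivisors ∣w∣² c (ℝᴿ.trans c-eq (vanish a b p q)) ∣w∣²≉0 ,ᶜ
    ℝ-noZeroDivisors ∣w∣² d (ℝᴿ.trans d-eq (vanish a (-ᴿ b) q p)) ∣w∣²≉0
    where
    ∣w∣² u v : ℝ
    ∣w∣² = a *ᴿ a +ᴿ b *ᴿ b
    u = a *ᴿ c +ᴿ -ᴿ (b *ᴿ d)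
    v = a *ᴿ d +ᴿ b *ᴿ c
    ∣w∣²≉0 : ¬ ∣w∣² ℝᴿ.≈ fromℚ 0ℚ
    ∣w∣²≉0 r = w≉0 (sumOfSquares≈0ˡ a b r ,ᶜ sumOfSquares≈0ʳ a b r)
    vanish : ∀ s t {x y} → x ℝᴿ.≈ fromℚ 0ℚ → y ℝᴿ.≈ fromℚ 0ℚ → s *ᴿ x +ᴿ t *ᴿ y ℝᴿ.≈ fromℚ 0ℚ
    vanish s t x≈0 y≈0 = ℝᴿ.trans
      (ℝᴿ.+-cong (ℝᴿ.trans (ℝᴿ.*-congˡ {s} x≈0) (ℝᴿ.zeroʳ s)) (ℝᴿ.trans (ℝᴿ.*-congˡ {t} y≈0) (ℝᴿ.zeroʳ t)))
      (ℝᴿ.+-identityˡ (fromℚ 0ℚ))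
    c-eq : ∣w∣² *ᴿ c ℝᴿ.≈ a *ᴿ u +ᴿ b *ᴿ v
    c-eq = pointwise λ n → solve 4 (λ a b c d →
      (a :* a :+ b :* b) :* c := a :* (a :* c :+ :- (b :* d)) :+ b :* (a :* d :+ b :* c))
      refl (seq a n) (seq b n) (seq c n) (seq d n)
    d-eq : ∣w∣² *ᴿ d ℝᴿ.≈ a *ᴿ v +ᴿ (-ᴿ b) *ᴿ u
    d-eq = pointwise λ n → solve 4 (λ a b c d →
      (a :* a :+ b :* b) :* d := a :* (a :* d :+ b :* c) :+ (:- b) :* (a :* c :+ :- (b :* d)))
      refl (seq a n) (seq b n) (seq c n) (seq d n)

  ℂ-characteristicZero : ∀ m → ¬ suc m ·ℕ 1# ≈ 0#
  ℂ-characteristicZero m (p ,ᶜ _) = apart⇒≉0 {re (suc m ·ℕ 1#)}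
    -- Apartness asks for a strict bound, while the absolute value equals 1 when `m` is zero; hence
    -- `½` and not `1ℚ`.
    (½ , ℚ.positive⁻¹ ½ , 0 , λ n _ → ℚ.<-≤-trans ½<1 (1≤∣∣ n)) p
    where
    ½<1 : ½ ℚ.< 1ℚ
    ½<1 = ℚ.*<* (ℤ.+<+ (ℕ.s≤s (ℕ.s≤s ℕ.z≤n)))
    0≤ : ∀ m n → 0ℚ ℚ.≤ seq (re (m ·ℕ 1#)) n
    0≤ zero    n = ℚ.≤-refl
    0≤ (suc m) n = ℚ.+-mono-≤ (ℚ.nonNegative⁻¹ 1ℚ) (0≤ m n)
    1≤∣∣ : ∀ n → 1ℚ ℚ.≤ ℚ.∣ seq (re (suc m ·ℕ 1#)) n ∣
    1≤∣∣ n = subst (1ℚ ℚ.≤_) (sym (ℚ.0≤p⇒∣p∣≡p (0≤ (suc m) n)))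
      (subst (ℚ._≤ seq (re (suc m ·ℕ 1#)) n) (ℚ.+-identityʳ 1ℚ) (ℚ.+-monoʳ-≤ 1ℚ (0≤ m n)))

ℂ-domain : IsDomainOfCharacteristicZero ℂ-commutativeRing
ℂ-domain = record
  { ≈-stable           = ≈ᶜ-stable
  ; noZeroDivisors     = ℂ-noZeroDivisors
  ; characteristicZero = ℂ-characteristicZero
  }

-- Indices and spheres of an association scheme.

module Scheme {n D} (𝔛 : SymmetricAssociationScheme n D) where
  open SymmetricAssociationScheme 𝔛
  open Equivalence

  R-index : ∀ y z → R (index y z) y z
  R-index y z = proj₁ (proj₂ (partition y z))

  R⇒index : ∀ {i y z} → R i y z → index y z ≡ i
  R⇒index {y = y} {z} = proj₂ (proj₂ (partition y z))

  index⇒R : ∀ {i y z} → index y z ≡ i → R i y z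
  index⇒R ≡.refl = R-index _ _

  index-refl : ∀ y → index y y ≡ zero
  index-refl y = R⇒index (from (diagonal y y) ≡.refl)

  index≡0⇒≡ : ∀ {y z} → index y z ≡ zero → y ≡ z
  index≡0⇒≡ eq = to (diagonal _ _) (index⇒R eq)

  index-sym : ∀ y z → index y z ≡ index z y
  index-sym y z = R⇒index (symmetric _ (R-index z y))

  index-surjective : ∀ k → Σ[ y ∈ Fin n ] Σ[ z ∈ Fin n ] index y z ≡ k
  index-surjective k = let y , z , r = nonempty k in y , z , R⇒index r

  -- The intersection number `p i i zero` is the valency of the relation `R i`, the same at every
  -- point. It is positive at the first point of some pair in `R i`, hence also at `x`.
  sphere-nonempty : ∀ x i → ∃[ y ] index x y ≡ i
  sphere-nonempty x i with nonempty i
  ... | y , z , r with intersection i i zero y y (from (diagonal y y) ≡.refl)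
                     | intersection i i zero x x (from (diagonal x x) ≡.refl)
  ...   | S , S⇔ , ∣S∣≡p | S′ , S′⇔ , ∣S′∣≡p =
    let w , w∈S′ = ∣p∣>0⇒Nonempty (≡.subst (0 ℕ.<_) (≡.trans ∣S∣≡p (≡.sym ∣S′∣≡p))
                     (x∈p⇒∣p∣>0 (from (S⇔ z) (r , symmetric i r))))
    in w , R⇒index (proj₁ (to (S′⇔ w) w∈S′))

-- The Bose-Mesner algebra as a ring of coefficient vectors.

module BoseMesnerAlgebra {n D} (𝔛 : SymmetricAssociationScheme n D)
  {c ℓ} (K : CommutativeRing c ℓ) where

  open SymmetricAssociationScheme 𝔛 using (index; p; intersection)
  open Scheme 𝔛
  open CommutativeRing K hiding (zero)
  open SemiringSum semiring
  open Mult +-monoid using () renaming (_×_ to _·ℕ_)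
  open SemiringSolver commutativeSemiring
  open Equivalence

  δ : Fin (suc D) → Fin (suc D) → Carrier
  δ i j = if ⌊ i Fin.≟ j ⌋ then 1# else 0#

  δ-yes : ∀ {i j} → i ≡ j → δ i j ≈ 1#
  δ-yes {i} {j} i≡j with i Fin.≟ j
  ... | yes _  = refl
  ... | no i≢j = contradiction i≡j i≢j

  sum-subset : ∀ {m} (S : Subset m) (f : Fin m → Carrier) →
               (∀ i → i ∈ S → f i ≈ 1#) → (∀ i → ¬ i ∈ S → f i ≈ 0#) →
               sum f ≈ ∣ S ∣ ·ℕ 1#
  sum-subset []            f on off = refl
  sum-subset (inside ∷ S)  f on off = +-cong (on zero here)
    (sum-subset S (f ∘ suc) (λ i → on (suc i) ∘ there) (λ i i∉ → off (suc i) (i∉ ∘ drop-there)))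
  sum-subset (outside ∷ S) f on off = trans
    (+-cong (off zero λ ())
      (sum-subset S (f ∘ suc) (λ i → on (suc i) ∘ there) (λ i i∉ → off (suc i) (i∉ ∘ drop-there))))
    (+-identityˡ _)

  -- The product of the two indicators is the indicator of the set counted by `intersection`; this
  -- is the expansion of `A i` times `A j` read off at one entry.
  sum-intersection : ∀ i j y z →
    sum (λ w → δ (index y w) i * δ (index w z) j) ≈ p i j (index y z) ·ℕ 1#
  sum-intersection i j y z with intersection i j _ y z (R-index y z)
  ... | S , S⇔ , ∣S∣≡p = trans (sum-subset S _ on off) (reflexive (≡.cong (_·ℕ 1#) ∣S∣≡p))
    where
    on : ∀ w → w ∈ S → δ (index y w) i * δ (index w z) j ≈ 1#
    on w w∈S with index y w Fin.≟ i | index w z Fin.≟ j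
    ... | yes _ | yes _ = *-identityˡ 1#
    ... | no ¬q | _     = contradiction (R⇒index (proj₁ (to (S⇔ w) w∈S))) ¬q
    ... | yes _ | no ¬q = contradiction (R⇒index (proj₂ (to (S⇔ w) w∈S))) ¬q
    off : ∀ w → ¬ w ∈ S → δ (index y w) i * δ (index w z) j ≈ 0#
    off w w∉S with index y w Fin.≟ i | index w z Fin.≟ j
    ... | yes q | yes r = contradiction (from (S⇔ w) (index⇒R q , index⇒R r)) w∉S
    ... | no _  | _     = zeroˡ _
    ... | yes _ | no _  = zeroʳ 1#

  -- b stands for the matrix with (y , z) entry b (index y z), that is ∑ₖ bₖ Aₖ.
  Coefficients : Set c
  Coefficients = Fin (suc D) → Carrier

  infix  4 _≋_
  infixl 7 _⊛_

  record _≋_ (b d : Coefficients) : Set ℓ where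
    constructor coefficientwise
    field
      at : ∀ k → b k ≈ d k
  open _≋_ public

  opaque
    -- Multiplication by structure constants. Being opaque, it is handled outside this block through
    -- `⊛-entry`, which identifies it with the matrix product.
    _⊛_ : Coefficients → Coefficients → Coefficients
    (b ⊛ d) k = sum λ i → sum λ j → b i * d j * (p i j k ·ℕ 1#)

    ⊛-entry : ∀ b d y z → (b ⊛ d) (index y z) ≈ sum λ w → b (index y w) * d (index w z)
    ⊛-entry b d y z = sym (begin
      sum (λ w → b (index y w) * d (index w z))
        ≈⟨ sum-cong-≋ (λ w → *-cong (sym (sum-indicatorʳ K b (index y w))) (sym (sum-indicatorʳ K d (index w z)))) ⟩
      sum (λ w → sum (λ i → b i * δ (index y w) i) * sum (λ j → d j * δ (index w z) j))
        ≈⟨ sum-cong-≋ (λ w → expand w) ⟩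
      sum (λ w → sum λ i → sum λ j → b i * d j * (δ (index y w) i * δ (index w z) j))
        ≈⟨ ∑-comm (λ w i → sum λ j → b i * d j * (δ (index y w) i * δ (index w z) j)) ⟩
      sum (λ i → sum λ w → sum λ j → b i * d j * (δ (index y w) i * δ (index w z) j))
        ≈⟨ sum-cong-≋ (λ i → ∑-comm λ w j → b i * d j * (δ (index y w) i * δ (index w z) j)) ⟩
      sum (λ i → sum λ j → sum λ w → b i * d j * (δ (index y w) i * δ (index w z) j))
        ≈⟨ sum-cong-≋ (λ i → sum-cong-≋ λ j → trans
             (sym (*-distribˡ-sum (b i * d j) λ w → δ (index y w) i * δ (index w z) j))
             (*-congˡ (sum-intersection i j y z))) ⟩
      (b ⊛ d) (index y z) ∎)
      where
      open SetoidReasoning setoid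
      expand : ∀ w → sum (λ i → b i * δ (index y w) i) * sum (λ j → d j * δ (index w z) j) ≈
                     sum λ i → sum λ j → b i * d j * (δ (index y w) i * δ (index w z) j)
      expand w = trans (*-distribʳ-sum s (λ i → b i * δ (index y w) i)) (sum-cong-≋ λ i → trans
          (*-distribˡ-sum (b i * δ (index y w) i) (λ j → d j * δ (index w z) j))
          (sum-cong-≋ λ j → solve 4 (λ a b c d → a :* b :* (c :* d) := a :* c :* (b :* d)) refl
            (b i) (δ (index y w) i) (d j) (δ (index w z) j)))
        where
        s : Carrier
        s = sum λ j → d j * δ (index w z) j

  scalar : Carrier → Coefficients
  scalar a k = if ⌊ k Fin.≟ zero ⌋ then a else 0#

  -- Every relation is nonempty, so every coefficient occurs as a matrix entry. This reduces the
  -- ring laws to those of matrices.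
  entrywise : ∀ {b d : Coefficients} →
              (∀ y z → b (index y z) ≈ d (index y z)) → b ≋ d
  entrywise {b} {d} h = coefficientwise λ k → let y , z , eq = index-surjective k in
    ≡.subst (λ k → b k ≈ d k) eq (h y z)

  ⊛-cong : ∀ {b b′ d d′} → b ≋ b′ → d ≋ d′ → b ⊛ d ≋ b′ ⊛ d′
  ⊛-cong {b} {b′} {d} {d′} b≋ d≋ = entrywise λ y z → begin
      (b ⊛ d) (index y z)                                ≈⟨ ⊛-entry b d y z ⟩
      sum (λ w → b (index y w) * d (index w z))          ≈⟨ sum-cong-≋ {n} (λ w → *-cong (at b≋ _) (at d≋ _)) ⟩
      sum (λ w → b′ (index y w) * d′ (index w z))        ≈⟨ ⊛-entry b′ d′ y z ⟨
      (b′ ⊛ d′) (index y z)                              ∎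
    where open SetoidReasoning setoid

  -- All matrices involved are symmetric: transposing the product reverses the factors and leaves
  -- the entries unchanged.
  ⊛-comm : ∀ b d → b ⊛ d ≋ d ⊛ b
  ⊛-comm b d = entrywise λ y z → begin
      (b ⊛ d) (index y z)                          ≈⟨ ⊛-entry b d y z ⟩
      sum (λ w → b (index y w) * d (index w z))    ≈⟨ sum-cong-≋ (λ w → trans (*-comm _ _)
        (reflexive (≡.cong₂ (λ i j → d i * b j) (index-sym w z) (index-sym y w)))) ⟩
      sum (λ w → d (index z w) * b (index w y))    ≈⟨ ⊛-entry d b z y ⟨
      (d ⊛ b) (index z y)                          ≡⟨ ≡.cong (d ⊛ b) (index-sym z y) ⟩
      (d ⊛ b) (index y z)                          ∎
    where open SetoidReasoning setoid

  ⊛-assoc : ∀ a b d → (a ⊛ b) ⊛ d ≋ a ⊛ (b ⊛ d)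
  ⊛-assoc a b d = entrywise λ y z → begin
      ((a ⊛ b) ⊛ d) (index y z)
        ≈⟨ ⊛-entry (a ⊛ b) d y z ⟩
      sum (λ w → (a ⊛ b) (index y w) * d (index w z))
        ≈⟨ sum-cong-≋ (λ w → trans (*-congʳ (⊛-entry a b y w))
             (trans (*-distribʳ-sum (d (index w z)) λ u → a (index y u) * b (index u w))
                    (sum-cong-≋ {n} λ u → *-assoc _ _ _))) ⟩
      sum (λ w → sum λ u → a (index y u) * (b (index u w) * d (index w z)))
        ≈⟨ ∑-comm (λ w u → a (index y u) * (b (index u w) * d (index w z))) ⟩
      sum (λ u → sum λ w → a (index y u) * (b (index u w) * d (index w z)))
        ≈⟨ sum-cong-≋ (λ u → trans
             (sym (*-distribˡ-sum (a (index y u)) λ w → b (index u w) * d (index w z)))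
             (*-congˡ (sym (⊛-entry b d u z)))) ⟩
      sum (λ u → a (index y u) * (b ⊛ d) (index u z))
        ≈⟨ ⊛-entry a (b ⊛ d) y z ⟨
      (a ⊛ (b ⊛ d)) (index y z) ∎
    where open SetoidReasoning setoid

  scalar-⊛ : ∀ a b → scalar a ⊛ b ≋ (λ k → a * b k)
  scalar-⊛ a b = entrywise λ y z → trans (⊛-entry (scalar a) b y z) (trans
      (sum-single +-commutativeMonoid y (λ w → scalar a (index y w) * b (index w z)) (off y z)) (on y z))
    where
    off : ∀ y z w → w ≢ y → scalar a (index y w) * b (index w z) ≈ 0#
    off y z w w≢y with index y w Fin.≟ zero
    ... | yes eq = contradiction (≡.sym (index≡0⇒≡ eq)) w≢y
    ... | no _   = zeroˡ _
    on : ∀ y z → scalar a (index y y) * b (index y z) ≈ a * b (index y z)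
    on y z with index y y Fin.≟ zero
    ... | yes _ = refl
    ... | no ¬q = contradiction (index-refl y) ¬q

  ⊛-distribˡ : ∀ a b d → a ⊛ (λ k → b k + d k) ≋ (λ k → (a ⊛ b) k + (a ⊛ d) k)
  ⊛-distribˡ a b d = entrywise λ y z → begin
      (a ⊛ (λ k → b k + d k)) (index y z)
        ≈⟨ ⊛-entry a _ y z ⟩
      sum (λ w → a (index y w) * (b (index w z) + d (index w z)))
        ≈⟨ sum-cong-≋ {n} (λ w → distribˡ _ _ _) ⟩
      sum (λ w → a (index y w) * b (index w z) + a (index y w) * d (index w z))
        ≈⟨ ∑-distrib-+ (λ w → a (index y w) * b (index w z)) _ ⟩
      sum (λ w → a (index y w) * b (index w z)) + sum (λ w → a (index y w) * d (index w z))
        ≈⟨ +-cong (⊛-entry a b y z) (⊛-entry a d y z) ⟨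
      (a ⊛ b) (index y z) + (a ⊛ d) (index y z) ∎
    where open SetoidReasoning setoid

  ≋-isEquivalence : IsEquivalence _≋_
  ≋-isEquivalence = record
    { refl  = coefficientwise λ k → refl
    ; sym   = λ p → coefficientwise λ k → sym (at p k)
    ; trans = λ p q → coefficientwise λ k → trans (at p k) (at q k)
    }

  𝕄 : CommutativeRing c ℓ
  𝕄 = record
    { Carrier = Coefficients
    ; _≈_ = _≋_
    ; _+_ = λ b d k → b k + d k
    ; _*_ = _⊛_
    ; -_ = λ b k → - b k
    ; 0# = λ _ → 0#
    ; 1# = scalar 1#
    ; isCommutativeRing = record
      { isRing = record
        { +-isAbelianGroup = record
          { isGroup = record
            { isMonoid = record
              { isSemigroup = record
                { isMagma = record
                  { isEquivalence = ≋-isEquivalence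
                  ; ∙-cong = λ p q → coefficientwise λ k → +-cong (at p k) (at q k)
                  }
                ; assoc = λ a b d → coefficientwise λ k → +-assoc (a k) (b k) (d k)
                }
              ; identity = (λ b → coefficientwise λ k → +-identityˡ (b k))
                         , (λ b → coefficientwise λ k → +-identityʳ (b k))
              }
            ; inverse = (λ b → coefficientwise λ k → -‿inverseˡ (b k))
                      , (λ b → coefficientwise λ k → -‿inverseʳ (b k))
            ; ⁻¹-cong = λ p → coefficientwise λ k → -‿cong (at p k)
            }
          ; comm = λ b d → coefficientwise λ k → +-comm (b k) (d k)
          }
        ; *-cong = ⊛-cong
        ; *-assoc = ⊛-assoc
        ; *-identity = identityˡ
                     , λ b → ≋-trans (⊛-comm b _) (identityˡ b)
        ; distrib = ⊛-distribˡ
                  , λ a b d → ≋-trans (⊛-comm _ a) (≋-trans (⊛-distribˡ a b d)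
                      (coefficientwise λ k → +-cong (at (⊛-comm a b) k) (at (⊛-comm a d) k)))
        }
      ; *-comm = ⊛-comm
      }
    }
    where
    open IsEquivalence ≋-isEquivalence using () renaming (trans to ≋-trans)
    identityˡ : ∀ b → scalar 1# ⊛ b ≋ b
    identityˡ b = ≋-trans (scalar-⊛ 1# b) (coefficientwise λ k → *-identityˡ (b k))

-- The path metric of a metric scheme.

module MetricScheme {n D} (𝔛 : SymmetricAssociationScheme n D)
  (metric : SymmetricAssociationScheme.Metric 𝔛) where
  open SymmetricAssociationScheme 𝔛
  open Metric metric
  open Scheme 𝔛
  open Equivalence

  dist : Fin n → Fin n → ℕ
  dist y z = toℕ (index y z)

  walk : ∀ y z → Walk Γ y z (dist y z)
  walk y z = proj₁ (to (distance _ y z) (R-index y z))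

  dist≤ : ∀ {y z l} → Walk Γ y z l → dist y z ℕ.≤ l
  dist≤ {y} {z} = proj₂ (to (distance _ y z) (R-index y z)) _

  _++_ : ∀ {y w z k l} → Walk Γ y w k → Walk Γ w z l → Walk Γ y z (k ℕ.+ l)
  []      ++ v = v
  (e ∷ u) ++ v = e ∷ (u ++ v)

  dist-triangle : ∀ y w z → dist y z ℕ.≤ dist y w ℕ.+ dist w z
  dist-triangle y w z = dist≤ (walk y w ++ walk w z)

  Γ⇒dist≡1 : ∀ {y w} → Γ y w → dist y w ≡ 1
  Γ⇒dist≡1 (i , i≡1 , r) = ≡.trans (≡.cong toℕ (R⇒index r)) i≡1

  -- `w` is the second vertex of a shortest walk. The rest of the walk bounds its distance to `z`
  -- from above, the triangle inequality from below.
  geodesic : ∀ y z {k} → dist y z ≡ suc k → ∃[ w ] dist w y ≡ 1 × dist w z ≡ k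
  geodesic y z {k} eq with ≡.subst (Walk Γ y z) eq (walk y z)
  ... | _∷_ {w = w} e u = w , ≡.trans (≡.cong toℕ (index-sym w y)) dist≡1 ,
        ℕ.≤-antisym (dist≤ u) (ℕ.s≤s⁻¹ (ℕ.≤-trans (ℕ.≤-reflexive (≡.sym eq))
          (ℕ.≤-trans (dist-triangle y w z) (ℕ.≤-reflexive (≡.cong (ℕ._+ dist w z) dist≡1)))))
    where
    dist≡1 : dist y w ≡ 1
    dist≡1 = Γ⇒dist≡1 e

-- Indecomposable idempotents in a commutative ring.

module Idempotents {c ℓ} (R : CommutativeRing c ℓ)
  (≈-stable : ∀ {a b} → ¬ ¬ CommutativeRing._≈_ R a b → CommutativeRing._≈_ R a b) where

  open CommutativeRing R
  open RingProperties ring using (x∙y⁻¹≈ε⇒x≈y; -‿distribˡ-*; -‿distribʳ-*; -0#≈0#)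
  open SemiringSolver commutativeSemiring
  open SetoidReasoning setoid

  IsNonzeroIdempotent : Carrier → Set ℓ
  IsNonzeroIdempotent e = e * e ≈ e × ¬ e ≈ 0#

  Indecomposable : Carrier → Set (c ⊔ ℓ)
  Indecomposable e = ∀ g h → IsNonzeroIdempotent g → IsNonzeroIdempotent h →
    g * h ≈ 0# → ¬ e ≈ g + h

  -- Otherwise `e = e f + (e - e f)` would split `e` into two nonzero orthogonal idempotents.
  indecomposable-absorbs : ∀ {e f} → e * e ≈ e → f * f ≈ f → Indecomposable e →
                           ¬ e * f ≈ 0# → e ≈ e * f
  indecomposable-absorbs {e} {f} ee≈e ff≈f indec g≉0 = ≈-stable λ e≉g →
    indec g (e + - g) (gg≈g , g≉0) (hh≈h , e≉g ∘ x∙y⁻¹≈ε⇒x≈y e g) gh≈0 e≈g+h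
    where
    g : Carrier
    g = e * f
    gg≈g : g * g ≈ g
    gg≈g = trans (solve 2 (λ e f → e :* f :* (e :* f) := e :* e :* (f :* f)) refl e f)
                 (*-cong ee≈e ff≈f)
    eg≈g : e * g ≈ g
    eg≈g = trans (sym (*-assoc e e f)) (*-congʳ ee≈e)
    gh≈0 : g * (e + - g) ≈ 0#
    gh≈0 = begin
      g * (e + - g)      ≈⟨ distribˡ g e (- g) ⟩
      g * e + g * - g    ≈⟨ +-cong (trans (*-comm g e) eg≈g) (trans (sym (-‿distribʳ-* g g)) (-‿cong gg≈g)) ⟩
      g + - g            ≈⟨ -‿inverseʳ g ⟩
      0#                 ∎
    hh≈h : (e + - g) * (e + - g) ≈ e + - g
    hh≈h = begin
      (e + - g) * (e + - g)              ≈⟨ distribʳ (e + - g) e (- g) ⟩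
      e * (e + - g) + - g * (e + - g)    ≈⟨ +-cong (distribˡ e e (- g)) (sym (-‿distribˡ-* g _)) ⟩
      e * e + e * - g + - (g * (e + - g)) ≈⟨ +-cong (+-cong ee≈e (trans (sym (-‿distribʳ-* e g)) (-‿cong eg≈g)))
                                                 (trans (-‿cong gh≈0) -0#≈0#) ⟩
      e + - g + 0#                       ≈⟨ +-identityʳ _ ⟩
      e + - g                            ∎
    e≈g+h : e ≈ g + (e + - g)
    e≈g+h = begin
      e                  ≈⟨ +-identityʳ e ⟨
      e + 0#             ≈⟨ +-congˡ (-‿inverseʳ g) ⟨
      e + (g + - g)      ≈⟨ solve 3 (λ e g m → e :+ (g :+ m) := g :+ (e :+ m)) refl e g (- g) ⟩
      g + (e + - g)      ∎

  -- If `e f` were nonzero, each of the two would absorb the other, giving `e = e f = f`.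
  indecomposables-orthogonal : ∀ {e f} → e * e ≈ e → f * f ≈ f →
    Indecomposable e → Indecomposable f → ¬ e ≈ f → e * f ≈ 0#
  indecomposables-orthogonal {e} {f} ee≈e ff≈f indecₑ indec-f e≉f = ≈-stable λ ef≉0 →
    e≉f (trans (indecomposable-absorbs ee≈e ff≈f indecₑ ef≉0)
      (trans (*-comm e f) (sym (indecomposable-absorbs ff≈f ee≈e indec-f
        (ef≉0 ∘ trans (*-comm e f))))))

-- Expansion in orthogonal idempotents.

module FrameOfIdempotents {n D} (𝔛 : SymmetricAssociationScheme n D)
  {c ℓ} {K : CommutativeRing c ℓ} (domain : IsDomainOfCharacteristicZero K) where

  open CommutativeRing K hiding (zero)
  open IsDomainOfCharacteristicZero domain
  open LinearDependence domain
  open BoseMesnerAlgebra 𝔛 K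
  module 𝕄 = CommutativeRing 𝕄
  open SemiringSum semiring
  open SemiringSum 𝕄.semiring using () renaming (sum to sumᴹ; *-distribʳ-sum to ⊛-distribʳ-sum)
  open RingProperties ring using (-‿distribˡ-*; -‿+-comm; -‿involutive; -0#≈0#)

  infixr 8 _•_
  _•_ : Carrier → Coefficients → Coefficients
  (a • b) k = a * b k

  ≋-stable : ∀ {b d} → ¬ ¬ b ≋ d → b ≋ d
  ≋-stable ¬¬b≋d = coefficientwise λ k → ≈-stable λ b≉d → ¬¬b≋d λ b≋d → b≉d (at b≋d k)

  •-cong : ∀ {a a′ b b′} → a ≈ a′ → b ≋ b′ → a • b ≋ a′ • b′
  •-cong p q = coefficientwise λ k → *-cong p (at q k)

  •-assoc : ∀ a a′ b → (a * a′) • b ≋ a • (a′ • b)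
  •-assoc a a′ b = coefficientwise λ k → *-assoc a a′ (b k)

  •-⊛ : ∀ a b d → (a • b) ⊛ d ≋ a • (b ⊛ d)
  •-⊛ a b d = begin
    (a • b) ⊛ d            ≈⟨ 𝕄.*-congʳ (scalar-⊛ a b) ⟨
    (scalar a ⊛ b) ⊛ d     ≈⟨ 𝕄.*-assoc (scalar a) b d ⟩
    scalar a ⊛ (b ⊛ d)     ≈⟨ scalar-⊛ a (b ⊛ d) ⟩
    a • (b ⊛ d)            ∎
    where open SetoidReasoning 𝕄.setoid

  ⊛-• : ∀ a b d → b ⊛ (a • d) ≋ a • (b ⊛ d)
  ⊛-• a b d = begin
    b ⊛ (a • d)     ≈⟨ 𝕄.*-comm b (a • d) ⟩
    (a • d) ⊛ b     ≈⟨ •-⊛ a d b ⟩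
    a • (d ⊛ b)     ≈⟨ •-cong refl (𝕄.*-comm d b) ⟩
    a • (b ⊛ d)     ∎
    where open SetoidReasoning 𝕄.setoid

  •-cancelʳ : ∀ {a b} → a • b ≋ 𝕄.0# → ¬ b ≋ 𝕄.0# → a ≈ 0#
  •-cancelʳ ab≋0 b≉0 = ≈-stable λ a≉0 → b≉0 (coefficientwise λ k → noZeroDivisors (at ab≋0 k) a≉0)

  sumᴹ-at : ∀ {m} (t : Fin m → Coefficients) k → sumᴹ t k ≡ sum (λ j → t j k)
  sumᴹ-at {zero}  t k = ≡.refl
  sumᴹ-at {suc m} t k = ≡.cong (λ s → t zero k + s) (sumᴹ-at (t ∘ suc) k)

  -- Spanning is not among the fields: it follows, up to a nonzero factor, from the number of
  -- idempotents, as `expansion` shows.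
  record IsFrame (E : Fin (suc D) → Coefficients) : Set ℓ where
    field
      idempotent : ∀ j → E j ⊛ E j ≋ E j
      nonzero    : ∀ j → ¬ E j ≋ 𝕄.0#
      orthogonal : ∀ {i j} → i ≢ j → E i ⊛ E j ≋ 𝕄.0#

  module _ {E : Fin (suc D) → Coefficients} (frame : IsFrame E) where
    open IsFrame frame

    combination : (Fin (suc D) → Carrier) → Coefficients
    combination e = sumᴹ λ j → e j • E j

    -- Orthogonality leaves only the summand at `k`, so multiplying by `E k` reads off a single
    -- coefficient.
    combination-⊛ : ∀ e k → combination e ⊛ E k ≋ e k • E k
    combination-⊛ e k = begin
      combination e ⊛ E k
        ≈⟨ ⊛-distribʳ-sum (E k) (λ j → e j • E j) ⟩
      sumᴹ (λ j → (e j • E j) ⊛ E k)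
        ≈⟨ sum-single 𝕄.+-commutativeMonoid k (λ j → (e j • E j) ⊛ E k) (λ j j≢k →
             𝕄.trans (•-⊛ (e j) (E j) (E k)) (𝕄.trans (•-cong refl (orthogonal j≢k))
               (coefficientwise λ _ → zeroʳ (e j)))) ⟩
      (e k • E k) ⊛ E k
        ≈⟨ •-⊛ (e k) (E k) (E k) ⟩
      e k • (E k ⊛ E k)
        ≈⟨ •-cong refl (idempotent k) ⟩
      e k • E k ∎
      where open SetoidReasoning 𝕄.setoid

    Expansion : Coefficients → Set _
    Expansion b = Σ[ a ∈ Carrier ] Σ[ e ∈ (Fin (suc D) → Carrier) ]
      ¬ a ≈ 0# × a • b ≋ combination e

    -- The D + 1 idempotents together with b are D + 2 vectors in K^{D+1}.  As K
    -- need not be a field, only a nonzero multiple of b is expanded.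
    expansion : ∀ b → ¬ ¬ Expansion b
    expansion b ¬exp = dependent v λ (r , r≉0 , rel) →
      let relᴹ : r zero • b 𝕄.+ combination (r ∘ suc) ≋ 𝕄.0#
          relᴹ = coefficientwise λ k → trans (reflexive (sumᴹ-at (λ i → r i • v i) k)) (rel k)
      in ¬exp (r zero , (λ j → - r (suc j)) , leading≉0 r r≉0 relᴹ , solved r relᴹ)
      where
      v : Fin (suc (suc D)) → Coefficients
      v zero    = b
      v (suc j) = E j
      -- Without `b` the relation would involve the idempotents alone; multiplying it by `E j` kills
      -- each remaining coefficient, contradicting nontriviality.
      leading≉0 : ∀ r → ¬ (∀ i → r i ≈ 0#) →
        r zero • b 𝕄.+ combination (r ∘ suc) ≋ 𝕄.0# → ¬ r zero ≈ 0#
      leading≉0 r r≉0 rel r₀≈0 = r≉0 r≈0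
        where
        combination≋0 : combination (r ∘ suc) ≋ 𝕄.0#
        combination≋0 = 𝕄.trans (coefficientwise λ k → trans (sym (+-identityˡ _))
          (+-congʳ (sym (trans (*-congʳ r₀≈0) (zeroˡ (b k)))))) rel
        rest : ∀ j → r (suc j) • E j ≋ 𝕄.0#
        rest j = 𝕄.trans (𝕄.sym (combination-⊛ (r ∘ suc) j))
          (𝕄.trans (𝕄.*-congʳ combination≋0) (𝕄.zeroˡ (E j)))
        r≈0 : ∀ i → r i ≈ 0#
        r≈0 zero    = r₀≈0
        r≈0 (suc j) = •-cancelʳ (rest j) (nonzero j)
      solved : ∀ r → r zero • b 𝕄.+ combination (r ∘ suc) ≋ 𝕄.0# →
        r zero • b ≋ combination λ j → - r (suc j)
      solved r rel = x∙y⁻¹≈ε⇒x≈yᴹ _ _ (𝕄.trans (𝕄.+-congˡ minus) rel)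
        where
        open RingProperties 𝕄.ring using () renaming (x∙y⁻¹≈ε⇒x≈y to x∙y⁻¹≈ε⇒x≈yᴹ)
        neg-sum : ∀ {m} (f : Fin m → Carrier) (t : Fin m → Carrier) →
          - sum (λ j → - f j * t j) ≈ sum (λ j → f j * t j)
        neg-sum {zero}  f t = -0#≈0#
        neg-sum {suc m} f t = trans (sym (-‿+-comm _ _))
          (+-cong (trans (-‿cong (sym (-‿distribˡ-* _ _))) (-‿involutive _))
                  (neg-sum (f ∘ suc) (t ∘ suc)))
        minus : 𝕄.- combination (λ j → - r (suc j)) ≋ combination (r ∘ suc)
        minus = coefficientwise λ k → trans
          (-‿cong (reflexive (sumᴹ-at (λ j → (- r (suc j)) • E j) k)))
          (trans (neg-sum (r ∘ suc) (λ j → E j k))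
            (sym (reflexive (sumᴹ-at (λ j → r (suc j) • E j) k))))

-- Eigenvalues of `A₁` and the vanishing functional.

module Codesign {n D} (𝔛 : SymmetricAssociationScheme n D)
  (metric : SymmetricAssociationScheme.Metric 𝔛)
  {c ℓ} {K : CommutativeRing c ℓ} (domain : IsDomainOfCharacteristicZero K)
  (one : Fin (suc D)) (one≡1 : toℕ one ≡ 1) where

  open SymmetricAssociationScheme 𝔛 using (index; p; intersection)
  open MetricScheme 𝔛 metric
  open Scheme 𝔛
  open CommutativeRing K hiding (zero)
  open IsDomainOfCharacteristicZero domain
  open BoseMesnerAlgebra 𝔛 K
  open FrameOfIdempotents 𝔛 domain
  open SemiringSum semiring
  open SemiringSum 𝕄.semiring using () renaming (sum to sumᴹ; *-distribˡ-sum to ⊛-distribˡ-sum; sum-cong-≋ to sumᴹ-cong)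
  open Mult +-monoid using () renaming (_×_ to _·ℕ_)
  open RingProperties ring using (-‿distribˡ-*; x∙y⁻¹≈ε⇒x≈y; x≈y⇒x∙y⁻¹≈ε; -‿+-comm; -‿distribʳ-*)
  open Equivalence

  A₁ : Coefficients
  A₁ k = δ k one

  -- The point `y` is itself one of those counted by this intersection number.
  p₁-positive : ∀ {k w y z} → index w y ≡ one → index y z ≡ k →
                ∃[ m ] p one k (index w z) ≡ suc m
  p₁-positive {k} {w} {y} {z} wy≡1 yz≡k with intersection one k _ w z (R-index w z)
  ... | S , S⇔ , ∣S∣≡p = _ , ≡.sym (ℕ.suc-pred _ {{ℕ.>-nonZero (≡.subst (0 ℕ.<_) ∣S∣≡p
    (x∈p⇒∣p∣>0 (from (S⇔ y) (index⇒R wy≡1 , index⇒R yz≡k))))}})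

  -- The three-term recurrence: for ∂(w , z) = m and an eigenvector W of A₁ with
  -- W vanishing up to distance m, the (w , z) entry of A₁ W is a positive
  -- multiple of the entry of W at distance m + 1.
  eigenvector-determined : ∀ {a θ W} → ¬ a ≈ 0# → (a • A₁) ⊛ W ≋ θ • W →
                           W zero ≈ 0# → W ≋ 𝕄.0#
  eigenvector-determined {a} {θ} {W} a≉0 eigen W₀≈0 =
    coefficientwise λ k → vanish (toℕ k) k ℕ.≤-refl
    where
    vanish : ∀ m k → toℕ k ℕ.≤ m → W k ≈ 0#
    vanish zero    zero k≤m = W₀≈0
    vanish (suc m) k k≤1+m with toℕ k ℕ.≤? m
    ... | yes k≤m = vanish m k k≤m
    ... | no  k≰m with index-surjective k
    ...   | y , z , yz≡k with geodesic y z (≡.trans (≡.cong toℕ yz≡k) (ℕ.≤-antisym k≤1+m (ℕ.≰⇒> k≰m)))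
    ...     | w , wy≡1 , wz≡m with p₁-positive (Fin.toℕ-injective (≡.trans wy≡1 (≡.sym one≡1))) yz≡k
    -- First `a` is cancelled, then the intersection number `suc q`, which is nonzero in
    -- characteristic zero.
    ...       | q , p≡1+q = noZeroDivisors (trans
                (sym (trans A₁W (*-congʳ (reflexive (≡.cong (_·ℕ 1#) p≡1+q)))))
                (noZeroDivisors aA₁W≈0 a≉0)) (characteristicZero q)
      where
      open SetoidReasoning setoid
      aA₁W≈0 : a * (A₁ ⊛ W) (index w z) ≈ 0#
      aA₁W≈0 = begin
        a * (A₁ ⊛ W) (index w z)        ≈⟨ at (•-⊛ a A₁ W) _ ⟨
        ((a • A₁) ⊛ W) (index w z)      ≈⟨ at eigen _ ⟩
        θ * W (index w z)               ≈⟨ *-congˡ (vanish m _ (ℕ.≤-reflexive wz≡m)) ⟩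
        θ * 0#                          ≈⟨ zeroʳ θ ⟩
        0#                              ∎
      -- A neighbour `u` of `w` is at distance at most `suc m` from `z`. Unless `index u z` is `k`,
      -- the distance is at most `m`, where `W` vanishes by induction.
      term : ∀ u → δ (index w u) one * W (index u z) ≈ δ (index w u) one * δ (index u z) k * W k
      term u with index w u Fin.≟ one
      ... | no _ = trans (zeroˡ _) (sym (trans (*-congʳ (zeroˡ _)) (zeroˡ _)))
      ... | yes wu≡1 with index u z Fin.≟ k
      ...   | yes uz≡k = trans (*-congˡ (reflexive (≡.cong W uz≡k))) (*-congʳ (sym (*-identityˡ 1#)))
      ...   | no  uz≢k = trans (*-congˡ (vanish m _ uz≤m)) (trans (zeroʳ 1#)
                           (sym (trans (*-congʳ (zeroʳ 1#)) (zeroˡ _))))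
        where
        uw≡1 : dist u w ≡ 1
        uw≡1 = ≡.trans (≡.cong toℕ (≡.trans (index-sym u w) wu≡1)) one≡1
        uz≤1+m : dist u z ℕ.≤ suc m
        uz≤1+m = ℕ.≤-trans (dist-triangle u w z) (ℕ.≤-reflexive (≡.cong₂ ℕ._+_ uw≡1 wz≡m))
        uz≢1+m : dist u z ≢ suc m
        uz≢1+m eq = uz≢k (Fin.toℕ-injective (≡.trans eq (≡.sym (ℕ.≤-antisym k≤1+m (ℕ.≰⇒> k≰m)))))
        uz≤m : dist u z ℕ.≤ m
        uz≤m = ℕ.s≤s⁻¹ (ℕ.≤∧≢⇒< uz≤1+m uz≢1+m)
      A₁W : (A₁ ⊛ W) (index w z) ≈ p one k (index w z) ·ℕ 1# * W k
      A₁W = begin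
        (A₁ ⊛ W) (index w z)
          ≈⟨ ⊛-entry A₁ W w z ⟩
        sum (λ u → δ (index w u) one * W (index u z))
          ≈⟨ sum-cong-≋ term ⟩
        sum (λ u → δ (index w u) one * δ (index u z) k * W k)
          ≈⟨ *-distribʳ-sum (W k) (λ u → δ (index w u) one * δ (index u z) k) ⟨
        sum (λ u → δ (index w u) one * δ (index u z) k) * W k
          ≈⟨ *-congʳ (sum-intersection one k w z) ⟩
        p one k (index w z) ·ℕ 1# * W k ∎

  -- In a metric scheme these are the polynomials in `A₁` of degree at most `m`, described here by
  -- their support.
  Degree≤ : ℕ → Coefficients → Set ℓ
  Degree≤ m b = ∀ k → m ℕ.< toℕ k → b k ≈ 0#

  degree-1 : Degree≤ 0 𝕄.1#
  degree-1 (suc k) _ = refl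

  -- By the triangle inequality, one step changes the distance by at most one, so every term of the
  -- matrix product vanishes.
  degree-A₁⊛ : ∀ {m b} → Degree≤ m b → Degree≤ (suc m) (A₁ ⊛ b)
  degree-A₁⊛ {m} {b} deg k 1+m<k with index-surjective k
  ... | y , z , ≡.refl = trans (⊛-entry A₁ b y z) (sum-ε +-commutativeMonoid _ term)
    where
    term : ∀ w → δ (index y w) one * b (index w z) ≈ 0#
    term w with index y w Fin.≟ one
    ... | no _     = zeroˡ _
    ... | yes yw≡1 = trans (*-congˡ (deg _ (ℕ.s<s⁻¹ (ℕ.<-≤-trans 1+m<k (ℕ.≤-trans (dist-triangle y w z)
                       (ℕ.≤-reflexive (≡.cong (ℕ._+ dist w z) (≡.trans (≡.cong toℕ yw≡1) one≡1)))))))) (zeroʳ 1#)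

  module Functional (χ : Fin n → Carrier) (y y′ : Fin n) where

    value : Fin n → Coefficients → Carrier
    value y b = sum λ z → b (index y z) * χ z

    F : Coefficients → Carrier
    F b = value y b + - value y′ b

    value-cong : ∀ y {b d} → b ≋ d → value y b ≈ value y d
    value-cong y b≋d = sum-cong-≋ λ z → *-congʳ (at b≋d (index y z))

    value-+ : ∀ y b d → value y (b 𝕄.+ d) ≈ value y b + value y d
    value-+ y b d = trans (sum-cong-≋ λ z → distribʳ (χ z) (b (index y z)) (d (index y z)))
      (∑-distrib-+ (λ z → b (index y z) * χ z) λ z → d (index y z) * χ z)

    value-• : ∀ y a b → value y (a • b) ≈ a * value y b
    value-• y a b = trans (sum-cong-≋ λ z → *-assoc a (b (index y z)) (χ z))
      (sym (*-distribˡ-sum a λ z → b (index y z) * χ z))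

    F-cong : ∀ {b d} → b ≋ d → F b ≈ F d
    F-cong b≋d = +-cong (value-cong y b≋d) (-‿cong (value-cong y′ b≋d))

    F-+ : ∀ b d → F (b 𝕄.+ d) ≈ F b + F d
    F-+ b d = trans (+-cong (value-+ y b d) (trans (-‿cong (value-+ y′ b d)) (sym (-‿+-comm _ _))))
      (medial (value y b) (value y d) (- value y′ b) (- value y′ d))
      where open CommutativeSemigroupProperties +-commutativeSemigroup
              using () renaming (interchange to medial)

    F-• : ∀ a b → F (a • b) ≈ a * F b
    F-• a b = trans (+-cong (value-• y a b) (trans (-‿cong (value-• y′ a b)) (-‿distribʳ-* a _)))
      (sym (distribˡ a _ _))

    F-sum : ∀ {m} (t : Fin m → Coefficients) → F (sumᴹ t) ≈ sum (F ∘ t)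
    F-sum {zero}  t = trans (+-cong (0-value y) (-‿cong (0-value y′))) (-‿inverseʳ 0#)
      where
      0-value : ∀ y → value y 𝕄.0# ≈ 0#
      0-value y = sum-ε +-commutativeMonoid _ λ z → zeroˡ (χ z)
    F-sum {suc m} t = trans (F-+ (t zero) (sumᴹ (t ∘ suc))) (+-congˡ (F-sum (t ∘ suc)))

    F≈0 : ∀ {b} → (∀ z → b (index y z) * χ z ≈ b (index y′ z) * χ z) → F b ≈ 0#
    F≈0 h = x≈y⇒x∙y⁻¹≈ε (sum-cong-≋ h)

  module Eigenvalues {E : Fin (suc D) → Coefficients} (frame : IsFrame E)
    {a : Carrier} (a≉0 : ¬ a ≈ 0#) (θ : Fin (suc D) → Carrier)
    (eigen : ∀ j → (a • A₁) ⊛ E j ≋ θ j • E j)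
    where

    open IsFrame frame

    T : Coefficients
    T = a • A₁

    -- If θ i = θ j then W = (E j)₀ E i - (E i)₀ E j is an eigenvector with zero
    -- diagonal, hence zero; multiplying by E i gives (E j)₀ = 0, hence E j = 0.
    eigenvalues-distinct : ∀ {i j} → i ≢ j → ¬ θ i ≈ θ j
    eigenvalues-distinct {i} {j} i≢j θi≈θj =
      nonzero j (eigenvector-determined a≉0 (eigen j) (•-cancelʳ multiple (nonzero i)))
      where
      open SetoidReasoning 𝕄.setoid
      u v : Carrier
      u = E j zero
      v = - E i zero
      W : Coefficients
      W = u • E i 𝕄.+ v • E j
      W-eigen : T ⊛ W ≋ θ i • W
      W-eigen = begin
        T ⊛ (u • E i 𝕄.+ v • E j)
          ≈⟨ 𝕄.distribˡ T (u • E i) (v • E j) ⟩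
        T ⊛ (u • E i) 𝕄.+ T ⊛ (v • E j)
          ≈⟨ 𝕄.+-cong (⊛-• u T (E i)) (⊛-• v T (E j)) ⟩
        u • (T ⊛ E i) 𝕄.+ v • (T ⊛ E j)
          ≈⟨ 𝕄.+-cong (•-cong refl (eigen i)) (•-cong refl (𝕄.trans (eigen j) (•-cong (sym θi≈θj) 𝕄.refl))) ⟩
        u • (θ i • E i) 𝕄.+ v • (θ i • E j)
          ≈⟨ coefficientwise (λ k → trans (+-cong (x∙yz≈y∙xz u (θ i) (E i k)) (x∙yz≈y∙xz v (θ i) (E j k)))
               (sym (distribˡ (θ i) _ _))) ⟩
        θ i • W ∎
        where open CommutativeSemigroupProperties *-commutativeSemigroup using (x∙yz≈y∙xz)
      W₀≈0 : W zero ≈ 0#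
      W₀≈0 = trans (+-congˡ (trans (sym (-‿distribˡ-* (E i zero) (E j zero))) (-‿cong (*-comm (E i zero) (E j zero)))))
        (-‿inverseʳ (E j zero * E i zero))
      multiple : u • E i ≋ 𝕄.0#
      multiple = begin
        u • E i
          ≈⟨ coefficientwise (λ k → trans (+-congˡ (zeroʳ v)) (+-identityʳ _)) ⟨
        u • E i 𝕄.+ v • 𝕄.0#
          ≈⟨ 𝕄.+-cong (•-cong refl (idempotent i)) (•-cong refl (orthogonal (i≢j ∘ ≡.sym))) ⟨
        u • (E i ⊛ E i) 𝕄.+ v • (E j ⊛ E i)
          ≈⟨ 𝕄.+-cong (•-⊛ u (E i) (E i)) (•-⊛ v (E j) (E i)) ⟨
        (u • E i) ⊛ E i 𝕄.+ (v • E j) ⊛ E i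
          ≈⟨ 𝕄.distribʳ (E i) (u • E i) (v • E j) ⟨
        W ⊛ E i
          ≈⟨ 𝕄.*-congʳ (eigenvector-determined a≉0 W-eigen W₀≈0) ⟩
        𝕄.0# ⊛ E i
          ≈⟨ 𝕄.zeroˡ (E i) ⟩
        𝕄.0# ∎

    -- The eigenvalue of `product L` on `E j`: an unnormalised Lagrange polynomial with nodes at the
    -- `θ l` for `l` in `L`, evaluated at `θ j`.
    π : List (Fin (suc D)) → Fin (suc D) → Carrier
    π []      j = 1#
    π (l ∷ L) j = (θ j + - θ l) * π L j

    π-zero : ∀ {L j} → j ∈ˡ L → π L j ≈ 0#
    π-zero {l ∷ L} (here ≡.refl) = trans (*-congʳ (-‿inverseʳ (θ l))) (zeroˡ _)
    π-zero {l ∷ L} (there j∈L)   = trans (*-congˡ (π-zero j∈L)) (zeroʳ _)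

    π-nonzero : ∀ {L j} → ¬ j ∈ˡ L → ¬ π L j ≈ 0#
    π-nonzero {[]}    j∉L π≈0 = 1≉0 π≈0
    π-nonzero {l ∷ L} {j} j∉L π≈0 = π-nonzero (j∉L ∘ there) (noZeroDivisors π≈0
      (eigenvalues-distinct (j∉L ∘ here) ∘ x∙y⁻¹≈ε⇒x≈y (θ j) (θ l)))

    product : List (Fin (suc D)) → Coefficients
    product []      = 𝕄.1#
    product (l ∷ L) = T ⊛ product L 𝕄.+ (- θ l) • product L

    product-degree : ∀ L → Degree≤ (length L) (product L)
    product-degree []      = degree-1
    product-degree (l ∷ L) k ≤k = trans
      (+-cong (trans (at (•-⊛ a A₁ (product L)) k) (trans (*-congˡ (degree-A₁⊛ (product-degree L) k ≤k)) (zeroʳ a)))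
        (trans (*-congˡ (product-degree L k (ℕ.<-trans (ℕ.n<1+n _) ≤k))) (zeroʳ _)))
      (+-identityˡ 0#)

    product-⊛ : ∀ L j → product L ⊛ E j ≋ π L j • E j
    product-⊛ []      j = scalar-⊛ 1# (E j)
    product-⊛ (l ∷ L) j = begin
      (T ⊛ B 𝕄.+ (- θ l) • B) ⊛ E j
        ≈⟨ 𝕄.distribʳ (E j) (T ⊛ B) _ ⟩
      (T ⊛ B) ⊛ E j 𝕄.+ ((- θ l) • B) ⊛ E j
        ≈⟨ 𝕄.+-cong (𝕄.*-assoc T B (E j)) (•-⊛ (- θ l) B (E j)) ⟩
      T ⊛ (B ⊛ E j) 𝕄.+ (- θ l) • (B ⊛ E j)
        ≈⟨ 𝕄.+-cong (𝕄.*-congˡ (product-⊛ L j)) (•-cong refl (product-⊛ L j)) ⟩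
      T ⊛ (π L j • E j) 𝕄.+ (- θ l) • (π L j • E j)
        ≈⟨ 𝕄.+-congʳ (𝕄.trans (⊛-• (π L j) T (E j)) (•-cong refl (eigen j))) ⟩
      π L j • (θ j • E j) 𝕄.+ (- θ l) • (π L j • E j)
        ≈⟨ coefficientwise (λ k → trans (+-cong (trans (x∙yz≈y∙xz _ _ _) (sym (*-assoc _ _ _))) (sym (*-assoc _ _ _)))
             (trans (sym (distribʳ (E j k) _ _)) (*-congʳ (sym (distribʳ (π L j) (θ j) (- θ l)))))) ⟩
      ((θ j + - θ l) * π L j) • E j ∎
      where
      open SetoidReasoning 𝕄.setoid
      open CommutativeSemigroupProperties *-commutativeSemigroup using (x∙yz≈y∙xz)
      B : Coefficients
      B = product L

  module _ {E : Fin (suc D) → Coefficients} (frame : IsFrame E)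
    (x : Fin n) (χ : Fin n → Carrier) (d : ℕ)
    (χ-vanishes : ∀ z → z ≢ x → dist x z ℕ.< d → χ z ≈ 0#)
    {y y′ : Fin n} (xy≡xy′ : index x y ≡ index x y′)
    where

    open Functional χ y y′

    -- The two sums agree term by term. At `x` the entries coincide since `y` and `y′` lie on the
    -- same sphere; elsewhere within distance less than `d` of `x`, `χ` vanishes; farther out, `z`
    -- is more than `m` away from `y` and `y′`, so both entries of `b` vanish.
    low-degree⇒F≈0 : ∀ {m b} → dist x y ℕ.+ m ℕ.< d → Degree≤ m b → F b ≈ 0#
    low-degree⇒F≈0 {m} {b} i+m<d deg = F≈0 {b} agree
      where
      far : ∀ y → dist x y ℕ.+ m ℕ.< d → ∀ z → ¬ dist x z ℕ.< d → b (index y z) ≈ 0#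
      far y i+m<d z xz≮d = deg _ (ℕ.+-cancelˡ-< (dist x y) _ _
        (ℕ.<-≤-trans i+m<d (ℕ.≤-trans (ℕ.≮⇒≥ xz≮d) (dist-triangle x y z))))
      agree : ∀ z → b (index y z) * χ z ≈ b (index y′ z) * χ z
      agree z with z Fin.≟ x
      ... | yes ≡.refl = *-congʳ (reflexive (≡.cong b
              (≡.trans (index-sym y x) (≡.trans xy≡xy′ (index-sym x y′)))))
      ... | no z≢x with dist x z ℕ.<? d
      ...   | yes xz<d = trans (*-congˡ χz≈0) (trans (zeroʳ _) (sym (trans (*-congˡ χz≈0) (zeroʳ _))))
        where
        χz≈0 : χ z ≈ 0#
        χz≈0 = χ-vanishes z z≢x xz<d
      ...   | no xz≮d = *-congʳ (trans (far y i+m<d z xz≮d) (sym (far y′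
                (≡.subst (λ k → toℕ k ℕ.+ m ℕ.< d) xy≡xy′ i+m<d) z xz≮d)))

    F-combination : ∀ {b} e → b ≋ combination frame e →
                    F b ≈ sum λ j → e j * F (E j)
    F-combination e b≋ = trans (F-cong b≋) (trans (F-sum (λ j → e j • E j))
      (sum-cong-≋ λ j → F-• (e j) (E j)))

    module _ (S : Subset (suc D)) (i+∣S∣≤d : dist x y ℕ.+ ∣ S ∣ ℕ.≤ d)
      (F-vanishes : ∀ j → ¬ j ∈ S → F (E j) ≈ 0#) where

      module _ {a} (e : Fin (suc D) → Carrier) (a≉0 : ¬ a ≈ 0#) (aA₁≋ : a • A₁ ≋ combination frame e)
        {a′} (e′ : Fin (suc D) → Carrier) (a′≉0 : ¬ a′ ≈ 0#) (a′1≋ : a′ • 𝕄.1# ≋ combination frame e′) where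

        open IsFrame frame
        open Eigenvalues frame a≉0 e
          (λ k → 𝕄.trans (𝕄.*-congʳ aA₁≋) (combination-⊛ frame e k))

        -- Multiplying the expansion of `a′ • 1` by `product L` gives a spectral decomposition,
        -- since each `E k` is an eigenvector.
        expand-product : ∀ L → a′ • product L ≋ combination frame (λ k → e′ k * π L k)
        expand-product L = begin
          a′ • B                              ≈⟨ •-cong refl (𝕄.*-identityʳ B) ⟨
          a′ • (B ⊛ 𝕄.1#)                     ≈⟨ ⊛-• a′ B 𝕄.1# ⟨
          B ⊛ (a′ • 𝕄.1#)                     ≈⟨ 𝕄.*-congˡ a′1≋ ⟩
          B ⊛ combination frame e′            ≈⟨ ⊛-distribˡ-sum B (λ k → e′ k • E k) ⟩
          sumᴹ (λ k → B ⊛ (e′ k • E k))       ≈⟨ sumᴹ-cong (λ k → 𝕄.trans (⊛-• (e′ k) B (E k))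
            (𝕄.trans (•-cong refl (product-⊛ L k)) (𝕄.sym (•-assoc (e′ k) (π L k) (E k))))) ⟩
          combination frame (λ k → e′ k * π L k) ∎
          where
          open SetoidReasoning 𝕄.setoid
          B : Coefficients
          B = product L

        -- Multiplying the expansion of `a′ • 1` by `E k` gives `a′ • E k = e′ k • E k`, so a zero
        -- coefficient would force `E k` to vanish.
        e′≉0 : ∀ k → ¬ e′ k ≈ 0#
        e′≉0 k e′k≈0 = nonzero k (coefficientwise λ i → noZeroDivisors (at a′Ek≋0 i) a′≉0)
          where
          a′Ek≋0 : a′ • E k ≋ 𝕄.0#
          a′Ek≋0 = 𝕄.trans (•-cong refl (𝕄.sym (𝕄.*-identityˡ (E k)))) (𝕄.trans (𝕄.sym (•-⊛ a′ 𝕄.1# (E k)))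
            (𝕄.trans (𝕄.*-congʳ a′1≋) (𝕄.trans (combination-⊛ frame e′ k)
              (coefficientwise λ i → trans (*-congʳ e′k≈0) (zeroˡ _)))))

        -- `F` of `product L` is computed twice: it is zero by low degree, and by expansion it is a
        -- multiple of `F (E j)` with nonzero factor `e′ j * π L j`.
        F-vanishes-on-S : ∀ {j} → j ∈ S → F (E j) ≈ 0#
        F-vanishes-on-S {j} j∈S = noZeroDivisors (begin
          e′ j * π L j * F (E j)
            ≈⟨ sum-single +-commutativeMonoid j (λ k → e′ k * π L k * F (E k)) off ⟨
          sum (λ k → e′ k * π L k * F (E k))
            ≈⟨ F-combination (λ k → e′ k * π L k) (expand-product L) ⟨
          F (a′ • product L)
            ≈⟨ F-• a′ (product L) ⟩
          a′ * F (product L)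
            ≈⟨ *-congˡ (low-degree⇒F≈0 (ℕ.<-≤-trans (ℕ.+-monoʳ-< (dist x y) short) i+∣S∣≤d) (product-degree L)) ⟩
          a′ * 0#
            ≈⟨ zeroʳ a′ ⟩
          0# ∎) λ e′π≈0 → π-nonzero j∉L (noZeroDivisors e′π≈0 (e′≉0 j))
          where
          open SetoidReasoning setoid
          L : List (Fin (suc D))
          L = filter (λ k → ¬? (k Fin.≟ j)) (elements S)
          -- Omitting `j` saves one factor; this turns the hypothesis `≤ d` into the strict
          -- inequality that `low-degree⇒F≈0` requires.
          short : length L ℕ.< ∣ S ∣
          short = ≡.subst (length L ℕ.<_) (length-elements S)
            (filter-notAll (λ k → ¬? (k Fin.≟ j)) (elements S)
              (Any.map (λ j≡k k≢j → k≢j (≡.sym j≡k)) (∈-elements j∈S)))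
          j∉L : ¬ j ∈ˡ L
          j∉L j∈L = proj₂ (∈-filter⁻ (λ k → ¬? (k Fin.≟ j)) {xs = elements S} j∈L) ≡.refl
          -- Outside `S` the functional vanishes by hypothesis; at the other indices of `S` the
          -- polynomial has a root.
          off : ∀ k → k ≢ j → e′ k * π L k * F (E k) ≈ 0#
          off k k≢j with k ∈? S
          ... | no k∉S  = trans (*-congˡ (F-vanishes k k∉S)) (zeroʳ _)
          ... | yes k∈S = trans (*-congʳ (trans
            (*-congˡ (π-zero (∈-filter⁺ (λ k → ¬? (k Fin.≟ j)) (∈-elements k∈S) k≢j))) (zeroʳ _))) (zeroˡ _)

      F-vanishes-on-idempotents : ∀ j → F (E j) ≈ 0#
      F-vanishes-on-idempotents j with j ∈? S
      ... | no j∉S  = F-vanishes j j∉S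
      -- The goal is a stable equation, so the doubly negated expansions of `A₁` and the identity
      -- may be opened.
      ... | yes j∈S = ≈-stable λ FEj≉0 →
        expansion frame A₁ λ (a , e , a≉0 , aA₁≋) →
        expansion frame 𝕄.1# λ (a′ , e′ , a′≉0 , a′1≋) →
        FEj≉0 (F-vanishes-on-S e a≉0 aA₁≋ e′ a′≉0 a′1≋ j∈S)

      -- A nonzero multiple of `b` is a combination of idempotents, all killed by `F`; the multiple
      -- is then cancelled.
      values-agree : ∀ b → value y b ≈ value y′ b
      values-agree b = x∙y⁻¹≈ε⇒x≈y _ _ (≈-stable λ Fb≉0 →
        expansion frame b λ (a , e , a≉0 , ab≋) → Fb≉0 (noZeroDivisors (begin
          a * F b                    ≈⟨ F-• a b ⟨
          F (a • b)                  ≈⟨ F-combination e ab≋ ⟩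
          sum (λ j → e j * F (E j))  ≈⟨ sum-ε +-commutativeMonoid _ (λ j →
                                          trans (*-congˡ (F-vanishes-on-idempotents j)) (zeroʳ (e j))) ⟩
          0#                         ∎) a≉0))
        where open SetoidReasoning setoid

-- Passage from coefficient vectors to complex matrices.

i≤m⊖n⇒i+n≤m : ∀ i m n → + i ℤ.≤ m ⊖ n → i ℕ.+ n ℕ.≤ m
i≤m⊖n⇒i+n≤m i m n i≤ = ℤ.drop‿+≤+ (begin
  + i ℤ.+ + n        ≤⟨ ℤ.+-monoˡ-≤ (+ n) i≤ ⟩
  m ⊖ n ℤ.+ + n      ≡⟨ ℤ.distribˡ-⊖-+-pos n m n ⟩
  (m ℕ.+ n) ⊖ n      ≡⟨ ℤ.⊖-≥ (ℕ.m≤n+m n m) ⟩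
  + (m ℕ.+ n ℕ.∸ n)  ≡⟨ ≡.cong +_ (ℕ.m+n∸n≡m m n) ⟩
  + m                ∎)
  where open ℤ.≤-Reasoning

open CommutativeRing ℂ-commutativeRing hiding (zero)
open IsDomainOfCharacteristicZero ℂ-domain
open SemiringSum semiring
open RingProperties ring using (x≈y⇒x∙y⁻¹≈ε; -‿distribˡ-*)

module _ {n : ℕ} where

  diag-· : ∀ (v w : V n) y → (diag v · w) y ≈ v y * w y
  diag-· v w y = sum-indicatorˡ ℂ-commutativeRing (v y) w y

  ·-basis : ∀ (B : Matrix n) x y → (B · basis x) y ≈ B y x
  ·-basis B x y = sum-indicatorʳ ℂ-commutativeRing (B y) x

  ∈Span⇒LinearlyDependent : ∀ {v w : V n} → v ∈Span w → LinearlyDependent v w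
  ∈Span⇒LinearlyDependent {v} {w} (a , v≈aw) = 1# , - a , 1≉0 ∘ proj₁ , λ y → trans
    (+-cong (trans (*-identityˡ (v y)) (v≈aw y)) (sym (-‿distribˡ-* a (w y))))
    (-‿inverseʳ (a * w y))

module Bridge {n D} (𝔛 : SymmetricAssociationScheme n D)
  {E : Fin (suc D) → Matrix n}
  (Es : SymmetricAssociationScheme.PrimitiveIdempotents 𝔛 E) where

  open SymmetricAssociationScheme 𝔛
  open Scheme 𝔛
  open BoseMesnerAlgebra 𝔛 ℂ-commutativeRing
  open FrameOfIdempotents 𝔛 ℂ-domain
  open Idempotents 𝕄 (λ {b} {d} → ≋-stable {b} {d})
  open PrimitiveIdempotents Es
  private
    module E (j : Fin (suc D)) where
      open PrimitiveIdempotent (each j) public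
      open NonzeroIdempotent nonzeroIdempotent public

  matrix : Coefficients → Matrix n
  matrix b y z = b (index y z)

  coefficients : Fin (suc D) → Coefficients
  coefficients j = proj₁ (E.member j)

  E≈ : ∀ j → E j ≈ᴹ matrix (coefficients j)
  E≈ j y z = trans (proj₂ (E.member j) y z) (sum-indicatorʳ ℂ-commutativeRing (coefficients j) (index y z))

  coefficients-idempotent : ∀ j → coefficients j ⊛ coefficients j ≋ coefficients j
  coefficients-idempotent j = entrywise λ y z → begin
    (e ⊛ e) (index y z)                           ≈⟨ ⊛-entry e e y z ⟩
    sum (λ w → e (index y w) * e (index w z))     ≈⟨ sum-cong-≋ (λ w → *-cong (E≈ j y w) (E≈ j w z)) ⟨
    (E j *ᴹ E j) y z                              ≈⟨ E.idempotent j y z ⟩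
    E j y z                                       ≈⟨ E≈ j y z ⟩
    e (index y z)                                 ∎
    where
    open SetoidReasoning setoid
    e : Coefficients
    e = coefficients j

  matrix-nonzeroIdempotent : ∀ {g} → IsNonzeroIdempotent g → NonzeroIdempotent (matrix g)
  matrix-nonzeroIdempotent {g} (gg≋g , g≉0) = record
    { member     = g , λ y z → sym (sum-indicatorʳ ℂ-commutativeRing g (index y z))
    ; idempotent = λ y z → trans (sym (⊛-entry g g y z)) (at gg≋g (index y z))
    ; nonzero    = g≉0 ∘ entrywise
    }

  -- A splitting of the coefficient vector is a splitting of the matrix `E j`, which primitivity
  -- excludes. The second vanishing product comes from commutativity.
  coefficients-indecomposable : ∀ j → Indecomposable (coefficients j)
  coefficients-indecomposable j g h g-idem h-idem gh≋0 e≋g+h = E.indecomposable j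
    ( matrix g , matrix h
    , matrix-nonzeroIdempotent g-idem , matrix-nonzeroIdempotent h-idem
    , (λ y z → trans (sym (⊛-entry g h y z)) (at gh≋0 (index y z)))
    , (λ y z → trans (sym (⊛-entry h g y z)) (at (𝕄.trans (𝕄.*-comm h g) gh≋0) (index y z)))
    , (λ y z → trans (E≈ j y z) (at e≋g+h (index y z))))

  frame : IsFrame coefficients
  frame = record
    { idempotent = coefficients-idempotent
    ; nonzero    = λ j e≋0 → E.nonzero j λ y z → trans (E≈ j y z) (at e≋0 (index y z))
    ; orthogonal = λ {i} {j} i≢j → indecomposables-orthogonal
        (coefficients-idempotent i) (coefficients-idempotent j)
        (coefficients-indecomposable i) (coefficients-indecomposable j)
        λ ei≋ej → i≢j (distinct i j λ y z →
          trans (E≈ i y z) (trans (at ei≋ej (index y z)) (sym (E≈ j y z))))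
    }

-- The codesign property of `A ℓ · χ`.

module _ {n D} (𝔛 : SymmetricAssociationScheme n D) where
  open SymmetricAssociationScheme 𝔛

  module _ (metric : Metric) (E : Fin (suc D) → Matrix n) (Es : PrimitiveIdempotents E)
    (x : Fin n) (χ : V n)
    (d : Fin (suc D)) (d-minimum : IsRelativeMinimumDistance x χ d)
    (s* : ℕ) (degree : IsDualDegree E χ s*) where

    open Scheme 𝔛
    open Bridge 𝔛 Es
    open PrimitiveIdempotents Es
    open Equivalence
    open BoseMesnerAlgebra 𝔛 ℂ-commutativeRing using (δ; δ-yes)

    -- A nonzero entry at such a `z` would make `index x z` a competitor below the minimum `d`.
    χ-vanishes : ∀ z → z ≢ x → toℕ (index x z) ℕ.< toℕ d → χ z ≈ 0#
    χ-vanishes z z≢x xz<d = ≈-stable λ χz≉0 → ℕ.<⇒≱ xz<d (proj₂ d-minimum (index x z)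
      ( (λ xz≡0 → z≢x (≡.sym (index≡0⇒≡ xz≡0)))
      , λ E*χ≈0 → χz≉0 (begin
          χ z                            ≈⟨ *-identityˡ (χ z) ⟨
          1# * χ z                       ≈⟨ *-congʳ A≈1 ⟨
          A (index x z) x z * χ z        ≈⟨ diag-· (A (index x z) x) χ z ⟨
          (E* (index x z) x · χ) z       ≈⟨ E*χ≈0 z ⟩
          0#                             ∎)))
      where
      open SetoidReasoning setoid
      A≈1 : A (index x z) x z ≈ 1#
      A≈1 = δ-yes ≡.refl

    -- There are two ways to lie outside the set: `E zero` has constant entries, so its values do
    -- not depend on the row; for any other such `j` the vector `E j · χ` vanishes by stability.
    ∉S⇒values-agree : ∀ j → ¬ j ∈ proj₁ degree → ∀ y y′ →
      sum (λ z → coefficients j (index y z) * χ z) ≈ sum (λ z → coefficients j (index y′ z) * χ z)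
    ∉S⇒values-agree j j∉S y y′ = [ zero-case , nonzero-case ]′ (toSum (j Fin.≟ zero))
      where
      value : Fin n → ℂ
      value y = sum λ z → coefficients j (index y z) * χ z
      constant : ∀ y z → coefficients zero (index y z) ≈ ∣X∣⁻¹J y z
      constant y z = trans (sym (E≈ zero y z)) (E₀ y z)
      zero-case : j ≡ zero → value y ≈ value y′
      zero-case ≡.refl = sum-cong-≋ λ z → *-congʳ (trans (constant y z) (sym (constant y′ z)))
      vanish : j ≢ zero → ∀ y → value y ≈ 0#
      vanish j≢0 y = trans (sum-cong-≋ λ z → *-congʳ (sym (E≈ j y z)))
        (≈-stable λ Eχ≉0 → j∉S (from (proj₁ (proj₂ degree) j) (j≢0 , λ Eχ≈0 → Eχ≉0 (Eχ≈0 y))))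
      nonzero-case : j ≢ zero → value y ≈ value y′
      nonzero-case j≢0 = trans (vanish j≢0 y) (sym (vanish j≢0 y′))

    module _ (ℓ i : Fin (suc D)) (1≤i : 1 ℕ.≤ toℕ i) (i≤t : + toℕ i ℤ.≤ toℕ d ⊖ s*) where
      1<1+D : 1 ℕ.< suc D
      1<1+D = ℕ.≤-<-trans 1≤i (Fin.toℕ<n i)

      -- The index of `A₁` exists because `1 ≤ i` forces `D` to be positive.
      one : Fin (suc D)
      one = fromℕ< 1<1+D

      open Codesign 𝔛 metric ℂ-domain one (Fin.toℕ-fromℕ< 1<1+D)

      values-constant : ∀ {y y′} → index x y ≡ i → index x y′ ≡ i → (A ℓ · χ) y ≈ (A ℓ · χ) y′
      values-constant {y} {y′} xy≡i xy′≡i = values-agree frame x χ (toℕ d) χ-vanishes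
        (≡.trans xy≡i (≡.sym xy′≡i)) (proj₁ degree) bound
        (λ j j∉S → x≈y⇒x∙y⁻¹≈ε (∉S⇒values-agree j j∉S y y′)) (λ k → δ k ℓ)
        where
        bound : toℕ (index x y) ℕ.+ ∣ proj₁ degree ∣ ℕ.≤ toℕ d
        bound = ≡.subst₂ (λ k s → toℕ k ℕ.+ s ℕ.≤ toℕ d) (≡.sym xy≡i) (≡.sym (proj₂ (proj₂ degree)))
          (i≤m⊖n⇒i+n≤m (toℕ i) (toℕ d) s* i≤t)

      E*Aχ∈Span : (E* i x · (A ℓ · χ)) ∈Span (A i · basis x)
      E*Aχ∈Span = a , λ y → begin
        (E* i x · (A ℓ · χ)) y     ≈⟨ diag-· (A i x) (A ℓ · χ) y ⟩
        A i x y * (A ℓ · χ) y      ≈⟨ on-sphere y ⟩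
        a * A i x y                ≡⟨ ≡.cong (λ k → a * (if ⌊ k Fin.≟ i ⌋ then 1# else 0#)) (index-sym x y) ⟩
        a * A i y x                ≈⟨ *-congˡ (·-basis (A i) x y) ⟨
        a * (A i · basis x) y      ∎
        where
        open SetoidReasoning setoid
        -- A base point on the sphere; the common value of `A ℓ · χ` there is the required scalar.
        y₀ : Fin n
        y₀ = proj₁ (sphere-nonempty x i)
        xy₀≡i : index x y₀ ≡ i
        xy₀≡i = proj₂ (sphere-nonempty x i)
        a : ℂ
        a = (A ℓ · χ) y₀
        on-sphere : ∀ y → A i x y * (A ℓ · χ) y ≈ a * A i x y
        on-sphere y = indicator-*-cong ℂ-commutativeRing λ xy≡i → values-constant xy≡i xy₀≡i

theorem3p2 : {n D : ℕ} (𝔛 : SymmetricAssociationScheme n D) →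
    let open SymmetricAssociationScheme 𝔛 in
    Metric →
    (E : Fin (suc D) → Matrix n) → PrimitiveIdempotents E →
    (x : Fin n) (χ : V n) → Code E χ →
    (δ : Fin (suc D)) → IsRelativeMinimumDistance x χ δ →
    (s* : ℕ) → IsDualDegree E χ s* →
    (ℓ : Fin (suc D)) →
    RelativeCodesign x (toℕ δ ⊖ s*) (A ℓ · χ) ×
    (∀ i → 1 ℕ.≤ toℕ i → + toℕ i ℤ.≤ toℕ δ ⊖ s* →
    (E* i x · (A ℓ · χ)) ∈Span (A i · basis x))
theorem3p2 𝔛 metric E Es x χ _ d d-minimum s* degree ℓ =
    (λ i 1≤i i≤t → ∈Span⇒LinearlyDependent (spans i 1≤i i≤t)) , spans
  where
  open SymmetricAssociationScheme 𝔛
  spans : ∀ i → 1 ℕ.≤ toℕ i → + toℕ i ℤ.≤ toℕ d ⊖ s* →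
    (E* i x · (A ℓ · χ)) ∈Span (A i · basis x)
  spans = E*Aχ∈Span 𝔛 metric E Es x χ d d-minimum s* degree ℓ
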